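{- There is an absolute constant $c>0$ such that the following holds. Let $n$ be a power of $2$ and let $f:[n]^d\to\{0,1\}$ be $\varepsilon$-far from being monotone. Then $I^-_f\cdot\Gamma^-_f\ge c\,\varepsilon^2$.
   Context: $[n]^d$ is partially ordered coordinatewise; $f$ is monotone if $f(x)\le f(y)$ whenever $x\preceq y$, and $\varepsilon$-far from monotone if it differs from every monotone function on at least an $\varepsilon n^d$ points. The augmented hypergrid $\mathbf{A}_{n,d}$ is the directed graph on $[n]^d$ with an edge $(x,y)$ whenever $x,y$ differ in exactly one coordinate $i$ and $y_i-x_i=2^a$ for some integer $a\ge0$ ($x$ is the lower endpoint). $S^-_f$ is the set of edges $(x,y)$ of $\mathbf{A}_{n,d}$ with $f(x)=1$ and $f(y)=0$. $I^-_f:=|S^-_f|/n^d$, and $\Gamma^-_f:=\frac{1}{n^d}\cdot$ (size of a maximum-cardinality matching contained in $S^-_f$). -}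

module Defs where

open import Data.Nat as ℕ using (ℕ; zero; suc; _^_)
open import Data.Fin as Fin using (Fin; toℕ)
open import Data.Bool as Bool using (Bool; true; false; _≟_)
open import Data.Vec using (Vec; []; _∷_; lookup)
open import Data.List using (List; []; _∷_; [_]; map; concatMap; filter; length)
open import Data.List.Membership.Propositional using (_∈_)
open import Data.List.Relation.Unary.All using (All)
open import Data.List.Relation.Unary.AllPairs using (AllPairs)
open import Data.List.Relation.Unary.Unique.Propositional using (Unique)
open import Data.Product using (Σ; ∃; _×_; _,_; proj₁; proj₂)
open import Data.Integer using (+_)
open import Data.Rational using (ℚ; _/_)
open import Relation.Binary.PropositionalEquality using (_≡_; _≢_)
open import Relation.Nullary using (¬_)
open import Function.Bundles using (_⇔_)

Point : ℕ → ℕ → Set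
Point n d = Vec (Fin n) d

_⪯_ : ∀ {n d} → Point n d → Point n d → Set
x ⪯ y = ∀ i → lookup x i Fin.≤ lookup y i

BoolFn : ℕ → ℕ → Set
BoolFn n d = Point n d → Bool

Monotone : ∀ {n d} → BoolFn n d → Set
Monotone f = ∀ x y → x ⪯ y → f x Bool.≤ f y

allPoints : (n d : ℕ) → List (Point n d)
allPoints n zero = [ [] ]
allPoints n (suc d) = concatMap (λ a → map (a ∷_) (allPoints n d)) (Data.List.allFin n)
  where import Data.List

dist : ∀ {n d} → BoolFn n d → BoolFn n d → ℕ
dist {n} {d} f g =
  length (filter (λ x → Relation.Nullary.¬? (f x ≟ g x)) (allPoints n d))
  where import Relation.Nullary

ℕtoℚ : ℕ → ℚ
ℕtoℚ k = + k / 1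

EpsFar : ∀ {n d} → ℚ → BoolFn n d → Set
EpsFar {n} {d} ε f = ∀ g → Monotone g → ε Data.Rational.* ℕtoℚ (n ^ d) Data.Rational.≤ ℕtoℚ (dist f g)
  where import Data.Rational

IsEdge : ∀ {n d} → Point n d → Point n d → Set
IsEdge {n} {d} x y =
  Σ (Fin d) λ i →
    (∀ j → j ≢ i → lookup x j ≡ lookup y j) ×
    ∃ λ a → toℕ (lookup y i) ≡ toℕ (lookup x i) ℕ.+ 2 ^ a

Pair : ℕ → ℕ → Set
Pair n d = Point n d × Point n d

InS⁻ : ∀ {n d} → BoolFn n d → Pair n d → Set
InS⁻ f (x , y) = IsEdge x y × f x ≡ true × f y ≡ false

CardS⁻ : ∀ {n d} → BoolFn n d → ℕ → Set
CardS⁻ {n} {d} f k =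
  Σ (List (Pair n d)) λ L →
    Unique L × (∀ e → (e ∈ L) ⇔ InS⁻ f e) × length L ≡ k

VertexDisjoint : ∀ {n d} → Pair n d → Pair n d → Set
VertexDisjoint (x , y) (x' , y') = x ≢ x' × x ≢ y' × y ≢ x' × y ≢ y'

IsMatchingInS⁻ : ∀ {n d} → BoolFn n d → List (Pair n d) → Set
IsMatchingInS⁻ f M = All (InS⁻ f) M × AllPairs VertexDisjoint M

IsPowerOf2 : ℕ → Set
IsPowerOf2 n = ∃ λ k → n ≡ 2 ^ k

{-# OPTIONS --safe #-}
module Submission where

-- Sort the zeros of f towards the bottom of the grid, one coordinate at a time; the result is
-- monotone.  A line of length 2^k is sorted by sorting its even and its odd positions and merging,
-- and a merge moves the zeros with at most twice as many power-of-two steps as there are violated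
-- unit edges between the two halves.  Sorting contracts the distance between parallel lines, so the
-- whole sort costs at most 2s steps, s = |S⁻|.  With dist f sorted = 2u this gives a matching of u
-- pairs x ≺ y, f x = 1, f y = 0, joined by walks of total length at most 2s.
--
-- Conversely, if C meets every violated edge then C meets every walk from such an x to such a y.
-- The Lehman–Ron routing argument only needs that steps commute, so it applies to the graph
-- unrolled in time (with idle steps allowed): pairs at distance at most K number at most (K+1)|C|.
-- Taking for C the endpoints of a maximal matching M in S⁻ gives u t ≤ 2|M|t² + 2s for all t ≥ 1,
-- and t ≈ 4s/u yields u² ≤ 32 s|M|.

open import Defs
import Algebra.Bundles
import Algebra.Properties.CommutativeSemigroup
open import Data.Bool using (Bool; true; false; not; _∧_; _xor_; T)
import Data.Bool as Bool
open import Data.Bool.Properties using (T-≡)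
open import Data.Empty using (⊥-elim)
open import Data.Fin as Fin using (Fin; toℕ; fromℕ<)
open import Data.Fin.Properties using (toℕ<n; toℕ-fromℕ<; toℕ-injective; fromℕ<-toℕ; all?)
import Data.Integer as ℤ
import Data.Integer.Properties as ℤ
open import Data.List using (List; []; _∷_; _++_; map; length; filter; filterᵇ; concatMap; downFrom; allFin; tabulate; cartesianProduct)
open import Data.List.Properties using (length-++; map-++; map-∘; map-cong; length-downFrom; map-tabulate; length-tabulate; concatMap-cong)
import Data.List.Membership.DecPropositional as DecMembership
open import Data.List.Membership.Propositional using (_∈_; _∉_; find; lose)
open import Data.List.Membership.Propositional.Properties using (∈-map⁺; ∈-concatMap⁺; ∈-concatMap⁻; ∈-allFin; ∈-cartesianProduct⁺; ∈-filter⁻)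
open import Data.List.Relation.Binary.Permutation.Propositional using (_↭_; ↭-sym; ↭-trans; ↭-reflexive; prep; swap; refl; module PermutationReasoning) renaming (trans to transᵖ)
import Data.List.Relation.Binary.Permutation.Propositional.Properties as Perm
open import Data.List.Relation.Binary.Pointwise using (Pointwise; []; _∷_; Pointwise-length)
import Data.List.Relation.Binary.Pointwise as Pointwise
open import Data.List.Relation.Unary.All using (All; []; _∷_)
import Data.List.Relation.Unary.All as All
import Data.List.Relation.Unary.All.Properties as Allₚ
open import Data.List.Relation.Unary.AllPairs using ([]; _∷_)
open import Data.List.Relation.Unary.Any using (Any; here; there; any?)
import Data.List.Relation.Unary.Any.Properties as Anyₚ
open import Data.List.Relation.Unary.Unique.Propositional using (Unique)
import Data.List.Relation.Unary.Unique.Propositional.Properties as Uniqueₚ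
open import Data.Maybe using (Maybe; just; nothing)
open import Data.Nat
open import Data.Nat.DivMod using (m≡m%n+[m/n]*n; m%n<n; m/n*n≤m)
open import Data.Nat.Properties
open Algebra.Properties.CommutativeSemigroup +-commutativeSemigroup using () renaming (interchange to +-interchange)
open import Data.Nat.Tactic.RingSolver using (solve-∀)
open import Data.Product using (Σ; ∃; ∃₂; _×_; _,_; proj₁; proj₂)
open import Data.Rational using (ℚ; 0ℚ)
open import Data.Rational as Q using ()
import Data.Rational.Properties as Q
import Data.Rational.Unnormalised as ℚᵘ
import Data.Rational.Unnormalised.Properties as ℚᵘ
open import Data.Sum using (_⊎_; inj₁; inj₂; [_,_]′)
open import Data.Vec using (Vec; []; _∷_; lookup; head; _[_]≔_)
open import Data.Vec.Properties using (lookup∘update; lookup∘update′; ≡-dec; ∷-injectiveʳ)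
open import Function using (_∘_; id; flip; _on_)
open import Function.Bundles using (Equivalence)
open import Relation.Binary.Definitions using (DecidableEquality)
open import Relation.Binary.PropositionalEquality hiding ([_])
open import Relation.Nullary using (¬_; Dec; yes; no; contradiction)
open import Relation.Nullary.Decidable using (map′; _×-dec_; _⊎-dec_; _→-dec_; ¬?)
open import Relation.Unary using (Decidable)

-- Finite sums and counting

-- What makes a merge cheap is that it depends only on the numbers of zeros in the two halves. These
-- do not change when the halves are sorted, so the violated unit edges of the given function can be
-- charged, rather than those of a half-sorted one. A step of length 2^a is a unit step on exactly
-- one level of the recursion, so every edge of the line pays once; the factor 2 is the price of
-- spreading a block of positions onto the odd ones.
--
-- Steps by powers of two admit no rank function, since two points may be joined by walks of
-- different lengths. This is why layers are indexed by time instead of rank. Disjoint walks are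
-- never constructed: it is enough that the layer just before the end is at least as large as the
-- family. Hall's theorem then moves all targets one step back, at the expense of a new pairing, and
-- for this reason the cut has to separate every source from every target, not just the paired ones.
-- Each of the K + 1 times costs at most |C| pairs.

private
  variable
    A B : Set

∑ : (A → ℕ) → List A → ℕ
∑ f [] = 0
∑ f (x ∷ xs) = f x + ∑ f xs

∑-mono : ∀ {f g : A → ℕ} xs → (∀ x → f x ≤ g x) → ∑ f xs ≤ ∑ g xs
∑-mono [] f≤g = z≤n
∑-mono (x ∷ xs) f≤g = +-mono-≤ (f≤g x) (∑-mono xs f≤g)

∑-cong : ∀ {f g : A → ℕ} xs → (∀ x → f x ≡ g x) → ∑ f xs ≡ ∑ g xs
∑-cong [] f≡g = refl
∑-cong (x ∷ xs) f≡g = cong₂ _+_ (f≡g x) (∑-cong xs f≡g)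

∑-++ : ∀ (f : A → ℕ) xs ys → ∑ f (xs ++ ys) ≡ ∑ f xs + ∑ f ys
∑-++ f [] ys = refl
∑-++ f (x ∷ xs) ys = trans (cong (f x +_) (∑-++ f xs ys)) (sym (+-assoc (f x) _ _))

∑-map : ∀ (f : B → ℕ) (g : A → B) xs → ∑ f (map g xs) ≡ ∑ (f ∘ g) xs
∑-map f g [] = refl
∑-map f g (x ∷ xs) = cong (f (g x) +_) (∑-map f g xs)

∑-concatMap : ∀ (f : B → ℕ) (g : A → List B) xs → ∑ f (concatMap g xs) ≡ ∑ (∑ f ∘ g) xs
∑-concatMap f g [] = refl
∑-concatMap f g (x ∷ xs) = trans (∑-++ f (g x) _) (cong (∑ f (g x) +_) (∑-concatMap f g xs))

∑-zero : (xs : List A) → ∑ (λ _ → 0) xs ≡ 0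
∑-zero [] = refl
∑-zero (x ∷ xs) = ∑-zero xs

∑-+ : ∀ (f g : A → ℕ) xs → ∑ (λ x → f x + g x) xs ≡ ∑ f xs + ∑ g xs
∑-+ f g [] = refl
∑-+ f g (x ∷ xs) = trans (cong (f x + g x +_) (∑-+ f g xs)) (+-interchange (f x) (g x) _ _)

∑-swap : ∀ (f : A → B → ℕ) xs ys → ∑ (λ x → ∑ (f x) ys) xs ≡ ∑ (λ y → ∑ (λ x → f x y) xs) ys
∑-swap f [] ys = sym (∑-zero ys)
∑-swap f (x ∷ xs) ys =
  trans (cong (∑ (f x) ys +_) (∑-swap f xs ys)) (sym (∑-+ (f x) (λ y → ∑ (λ x → f x y) xs) ys))

∑-*ˡ : ∀ c (f : A → ℕ) xs → ∑ (λ x → c * f x) xs ≡ c * ∑ f xs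
∑-*ˡ c f [] = sym (*-zeroʳ c)
∑-*ˡ c f (x ∷ xs) = trans (cong (c * f x +_) (∑-*ˡ c f xs)) (sym (*-distribˡ-+ c (f x) _))

∑-↭ : ∀ (f : A → ℕ) {xs ys} → xs ↭ ys → ∑ f xs ≡ ∑ f ys
∑-↭ f refl = refl
∑-↭ f (prep x p) = cong (f x +_) (∑-↭ f p)
∑-↭ f {x ∷ y ∷ xs} {_ ∷ _ ∷ ys} (swap _ _ p) = begin
  f x + (f y + ∑ f xs) ≡⟨ cong (λ z → f x + (f y + z)) (∑-↭ f p) ⟩
  f x + (f y + ∑ f ys) ≡⟨ sym (+-assoc (f x) (f y) _) ⟩
  f x + f y + ∑ f ys   ≡⟨ cong (_+ ∑ f ys) (+-comm (f x) (f y)) ⟩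
  f y + f x + ∑ f ys   ≡⟨ +-assoc (f y) (f x) _ ⟩
  f y + (f x + ∑ f ys) ∎
  where open ≡-Reasoning
∑-↭ f (transᵖ p q) = trans (∑-↭ f p) (∑-↭ f q)

ind : ∀ {P : Set} → Dec P → ℕ
ind (yes _) = 1
ind (no _) = 0

ind≤ : ∀ {P Q : Set} (p : Dec P) (q : Dec Q) → (P → Q) → ind p ≤ ind q
ind≤ (no _) q f = z≤n
ind≤ (yes p) (yes q) f = ≤-refl
ind≤ (yes p) (no ¬q) f = contradiction (f p) ¬q

ind-no : ∀ {P : Set} (p : Dec P) → ¬ P → ind p ≡ 0
ind-no (yes p) ¬p = contradiction p ¬p
ind-no (no _) ¬p = refl

# : ∀ {P : A → Set} → Decidable P → List A → ℕ
# P? = ∑ (λ x → ind (P? x))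

#-mono : ∀ {P Q : A → Set} (P? : Decidable P) (Q? : Decidable Q) xs → (∀ {x} → P x → Q x) → # P? xs ≤ # Q? xs
#-mono P? Q? xs f = ∑-mono xs (λ x → ind≤ (P? x) (Q? x) f)

length-filter≡# : ∀ {P : A → Set} (P? : Decidable P) xs → length (filter P? xs) ≡ # P? xs
length-filter≡# P? [] = refl
length-filter≡# P? (x ∷ xs) with P? x
... | yes _ = cong suc (length-filter≡# P? xs)
... | no _ = length-filter≡# P? xs

#-filter : ∀ {P Q : A → Set} (P? : Decidable P) (Q? : Decidable Q) xs → (∀ {x} → P x → Q x) → # P? (filter Q? xs) ≡ # P? xs
#-filter P? Q? [] f = refl
#-filter P? Q? (x ∷ xs) f with Q? x
... | yes _ = cong (ind (P? x) +_) (#-filter P? Q? xs f)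
... | no ¬q = trans (#-filter P? Q? xs f) (cong (_+ # P? xs) (sym (ind-no (P? x) (¬q ∘ f))))

∑-filter : ∀ {Q : A → Set} (Q? : Decidable Q) (f : A → ℕ) xs → (∀ x → ¬ Q x → f x ≡ 0) → ∑ f xs ≡ ∑ f (filter Q? xs)
∑-filter Q? f [] z = refl
∑-filter Q? f (x ∷ xs) z with Q? x
... | yes _ = cong (f x +_) (∑-filter Q? f xs z)
... | no ¬q = trans (cong (_+ ∑ f xs) (z x ¬q)) (∑-filter Q? f xs z)

filter-↭ : ∀ {Q : A → Set} (Q? : Decidable Q) xs → xs ↭ filter Q? xs ++ filter (¬? ∘ Q?) xs
filter-↭ Q? [] = refl
filter-↭ Q? (x ∷ xs) with Q? x
... | yes _ = prep x (filter-↭ Q? xs)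
... | no _ = ↭-trans (prep x (filter-↭ Q? xs)) (↭-sym (Perm.shift x (filter Q? xs) _))

#-positive : ∀ {P : A → Set} (P? : Decidable P) {x xs} → x ∈ xs → P x → 1 ≤ # P? xs
#-positive P? {x} (here refl) px with P? x
... | yes _ = s≤s z≤n
... | no ¬p = contradiction px ¬p
#-positive P? {xs = y ∷ xs} (there x∈) px = ≤-trans (#-positive P? x∈ px) (m≤n+m _ (ind (P? y)))

#-zero : ∀ {P : A → Set} (P? : Decidable P) xs → (∀ {x} → x ∈ xs → ¬ P x) → # P? xs ≡ 0
#-zero P? [] ¬p = refl
#-zero P? (x ∷ xs) ¬p = cong₂ _+_ (ind-no (P? x) (¬p (here refl))) (#-zero P? xs (¬p ∘ there))

#-find : ∀ {P : A → Set} (P? : Decidable P) xs → 1 ≤ # P? xs → ∃₂ λ x ys → P x × xs ↭ x ∷ ys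
#-find P? (x ∷ xs) le with P? x
... | yes p = x , xs , p , refl
... | no _ with #-find P? xs le
...   | y , ys , p , e = y , x ∷ ys , p , ↭-trans (prep x e) (swap x y refl)

#-≤-functional : ∀ {P : A → Set} {Q : B → Set} (P? : Decidable P) (Q? : Decidable Q) xs ys → Unique xs →
  (∀ {x x'} → P x → P x' → x ≡ x') → (∀ {x} → x ∈ xs → P x → ∃ λ y → y ∈ ys × Q y) → # P? xs ≤ # Q? ys
#-≤-functional P? Q? [] ys _ _ _ = z≤n
#-≤-functional {P = P} P? Q? (x ∷ xs) ys (x∉ ∷ u) fun imp with P? x
... | no _ = #-≤-functional P? Q? xs ys u fun (imp ∘ there)
... | yes p with imp (here refl) p
...   | y , y∈ , q = begin
  suc (# P? xs) ≡⟨ cong suc (#-zero P? xs (λ z∈ pz → All.lookup x∉ z∈ (fun p pz))) ⟩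
  1             ≤⟨ #-positive Q? y∈ q ⟩
  # Q? ys       ∎
  where open ≤-Reasoning

∈⇒↭ : ∀ {x : A} {xs} → x ∈ xs → ∃ λ ys → xs ↭ x ∷ ys
∈⇒↭ {xs = x ∷ xs} (here refl) = xs , refl
∈⇒↭ {xs = y ∷ xs} (there p) with ∈⇒↭ p
... | ys , e = y ∷ ys , ↭-trans (prep y e) (swap y _ refl)

unique-length≤# : ∀ {P : A → Set} (P? : Decidable P) {xs ys} → Unique xs → (∀ {x} → x ∈ xs → x ∈ ys × P x) → length xs ≤ # P? ys
unique-length≤# P? {[]} u sub = z≤n
unique-length≤# P? {x ∷ xs} {ys} (x∉ ∷ u) sub with sub (here refl)
... | x∈ys , px with ∈⇒↭ x∈ys
...   | zs , e = begin
  suc (length xs)       ≤⟨ s≤s (unique-length≤# P? u sub′) ⟩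
  suc (# P? zs)         ≤⟨ +-monoˡ-≤ (# P? zs) (indyes (P? x)) ⟩
  ind (P? x) + # P? zs  ≡⟨ sym (∑-↭ _ e) ⟩
  # P? ys               ∎
  where
  open ≤-Reasoning
  indyes : (d : Dec _) → 1 ≤ ind d
  indyes (yes _) = ≤-refl
  indyes (no ¬p) = contradiction px ¬p
  sub′ : ∀ {y} → y ∈ xs → y ∈ zs × _
  sub′ y∈ with sub (there y∈)
  ... | y∈ys , py with Perm.∈-resp-↭ e y∈ys
  ...   | here refl = contradiction refl (All.lookup x∉ y∈)
  ...   | there q = q , py

unique-length≤ : ∀ {xs ys : List A} → Unique xs → (∀ {x} → x ∈ xs → x ∈ ys) → length xs ≤ length ys
unique-length≤ {xs = []} u sub = z≤n
unique-length≤ {xs = x ∷ xs} {ys} (x∉ ∷ u) sub with ∈⇒↭ (sub (here refl))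
... | zs , e = ≤-trans (s≤s (unique-length≤ u sub′)) (≤-reflexive (sym (Perm.↭-length e)))
  where
  sub′ : ∀ {y} → y ∈ xs → y ∈ zs
  sub′ y∈ with Perm.∈-resp-↭ e (sub (there y∈))
  ... | here refl = contradiction refl (All.lookup x∉ y∈)
  ... | there q = q

-- Complementary sublists and Hall's marriage theorem

data Split {A : Set} : List A → List A → List A → Set where
  []    : Split [] [] []
  left  : ∀ {x xs ys zs} → Split xs ys zs → Split (x ∷ xs) (x ∷ ys) zs
  right : ∀ {x xs ys zs} → Split xs ys zs → Split (x ∷ xs) ys (x ∷ zs)

split-length : ∀ {xs ys zs : List A} → Split xs ys zs → length ys + length zs ≡ length xs
split-length [] = refl
split-length (left s) = cong suc (split-length s)
split-length {ys = ys} (right {zs = zs} s) = trans (+-suc (length ys) (length zs)) (cong suc (split-length s))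

split-∈ : ∀ {xs ys zs : List A} {x} → Split xs ys zs → x ∈ ys → x ∈ xs
split-∈ (left s) (here e) = here e
split-∈ (left s) (there p) = there (split-∈ s p)
split-∈ (right s) p = there (split-∈ s p)

split-unique : ∀ {xs ys zs : List A} → Split xs ys zs → Unique xs → Unique ys
split-unique [] [] = []
split-unique (left s) (x∉ ∷ u) = All.tabulate (λ y∈ → All.lookup x∉ (split-∈ s y∈)) ∷ split-unique s u
split-unique (right s) (_ ∷ u) = split-unique s u

split-all⁻ : ∀ {xs ys : List A} → Split xs ys [] → ys ≡ xs
split-all⁻ [] = refl
split-all⁻ (left s) = cong (_ ∷_) (split-all⁻ s)

split-trans : ∀ {xs ys zs us vs : List A} → Split xs ys zs → Split ys us vs → ∃ λ ws → Split xs us ws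
split-trans [] [] = [] , []
split-trans (left s) (left t) = let ws , r = split-trans s t in ws , left r
split-trans (left {x = x} s) (right t) = let ws , r = split-trans s t in x ∷ ws , right r
split-trans (right {x = x} s) t = let ws , r = split-trans s t in x ∷ ws , right r

split-union : ∀ {xs ys zs us vs : List A} → Split xs ys zs → Split zs us vs → ∃ λ ws → Split xs ws vs × ws ↭ ys ++ us
split-union [] [] = [] , [] , refl
split-union (left {x = x} s) t = let ws , r , e = split-union s t in x ∷ ws , left r , prep x e
split-union {ys = ys} (right {x = x} s) (left t) =
  let ws , r , e = split-union s t in x ∷ ws , left r , ↭-trans (prep x e) (↭-sym (Perm.shift x ys _))
split-union (right s) (right t) = let ws , r , e = split-union s t in ws , right r , e

split-pointwise : ∀ {R : A → B → Set} {xs ys J K} → Split xs J K → Pointwise R xs ys →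
  ∃₂ λ J′ K′ → Split ys J′ K′ × Pointwise R J J′
split-pointwise [] [] = [] , [] , [] , []
split-pointwise (left s) (r ∷ rs) = let J′ , K′ , t , q = split-pointwise s rs in _ ∷ J′ , K′ , left t , r ∷ q
split-pointwise (right s) (r ∷ rs) = let J′ , K′ , t , q = split-pointwise s rs in J′ , _ ∷ K′ , right t , q

pointwise-merge : ∀ {R : A → B → Set} {xs J K us vs} → Split xs J K → Pointwise R J us → Pointwise R K vs →
  ∃ λ ys → Pointwise R xs ys × ys ↭ us ++ vs
pointwise-merge [] [] [] = [] , [] , refl
pointwise-merge (left s) (r ∷ p) q = let ys , pw , e = pointwise-merge s p q in _ ∷ ys , r ∷ pw , prep _ e
pointwise-merge {us = us} (right s) p (r ∷ q) =
  let ys , pw , e = pointwise-merge s p q in _ ∷ ys , r ∷ pw , ↭-trans (prep _ e) (↭-sym (Perm.shift _ us _))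

-- Exhaustive search over all splittings. It lets the proof of Hall's theorem branch constructively
-- on whether a tight sublist exists.
split? : ∀ {P : List A → List A → Set} → (∀ J K → Dec (P J K)) → ∀ xs → Dec (∃₂ λ J K → Split xs J K × P J K)
split? P? [] = map′ (λ p → [] , [] , [] , p) (λ { (_ , _ , [] , p) → p }) (P? [] [])
split? {P = P} P? (x ∷ xs) =
  map′ to from (split? (λ J K → P? (x ∷ J) K) xs ⊎-dec split? (λ J K → P? J (x ∷ K)) xs)
  where
  to : _ ⊎ _ → _
  to (inj₁ (J , K , s , p)) = _ , _ , left s , p
  to (inj₂ (J , K , s , p)) = _ , _ , right s , p
  from : _ → _ ⊎ _
  from (_ , _ , left s , p) = inj₁ (_ , _ , s , p)
  from (_ , _ , right s , p) = inj₂ (_ , _ , s , p)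

module Hall {A B : Set} (E : A → B → Set) (E? : ∀ a b → Dec (E a b)) where

  Nbr : List A → B → Set
  Nbr J b = Any (λ a → E a b) J

  nbr? : ∀ J → Decidable (Nbr J)
  nbr? J b = any? (λ a → E? a b) J

  HallCondition : List A → List B → Set
  HallCondition L U = ∀ {J K} → Split L J K → length J ≤ # (nbr? J) U

  Matching : List A → List B → Set
  Matching L U = ∃₂ λ ys zs → Pointwise E L ys × U ↭ ys ++ zs

  -- With both parts nonempty, each is strictly shorter than the whole, so the induction applies to
  -- both.
  Tight : List B → List A → List A → Set
  Tight U J K = 1 ≤ length J × 1 ≤ length K × # (nbr? J) U ≤ length J

  tight? : ∀ U J K → Dec (Tight U J K)
  tight? U J K = (1 ≤? length J) ×-dec ((1 ≤? length K) ×-dec (# (nbr? J) U ≤? length J))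

  condition-left : ∀ {L U J K} → HallCondition L U → Split L J K → HallCondition J (filter (nbr? J) U)
  condition-left {U = U} {J} hc s {J₁} t = begin
    length J₁                         ≤⟨ hc (proj₂ (split-trans s t)) ⟩
    # (nbr? J₁) U                     ≡⟨ sym (#-filter (nbr? J₁) (nbr? J) U sub) ⟩
    # (nbr? J₁) (filter (nbr? J) U)   ∎
    where
    open ≤-Reasoning
    sub : ∀ {b} → Nbr J₁ b → Nbr J b
    sub n = let a , a∈ , e = find n in lose (split-∈ t a∈) e

  -- The condition is applied to the union `W` of `J` and `K₁`. By tightness the neighbours of `J`
  -- account for at most `length J`, so at least `length K₁` neighbours of `W` remain, and these are
  -- neighbours of `K₁`.
  condition-right : ∀ {L U J K} → HallCondition L U → Split L J K → # (nbr? J) U ≤ length J →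
    HallCondition K (filter (¬? ∘ nbr? J) U)
  condition-right {U = U} {J} hc s tight {K₁} t with split-union s t
  ... | W , r , e = +-cancelˡ-≤ (length J) _ _ (begin
    length J + length K₁                       ≡⟨ sym (length-++ J) ⟩
    length (J ++ K₁)                           ≡⟨ sym (Perm.↭-length e) ⟩
    length W                                   ≤⟨ hc r ⟩
    # (nbr? W) U                               ≡⟨ ∑-↭ _ (filter-↭ (nbr? J) U) ⟩
    # (nbr? W) (U₁ ++ U₂)                      ≡⟨ ∑-++ _ U₁ U₂ ⟩
    # (nbr? W) U₁ + # (nbr? W) U₂              ≤⟨ +-mono-≤ (#≤length (nbr? W) U₁) (onto-U₂ U) ⟩
    length U₁ + # (nbr? K₁) U₂                 ≡⟨ cong (_+ # (nbr? K₁) U₂) (length-filter≡# (nbr? J) U) ⟩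
    # (nbr? J) U + # (nbr? K₁) U₂              ≤⟨ +-monoˡ-≤ _ tight ⟩
    length J + # (nbr? K₁) U₂                  ∎)
    where
    open ≤-Reasoning
    U₁ = filter (nbr? J) U
    U₂ = filter (¬? ∘ nbr? J) U
    #≤length : ∀ {P : B → Set} (P? : Decidable P) xs → # P? xs ≤ length xs
    #≤length P? [] = z≤n
    #≤length P? (x ∷ xs) with P? x
    ... | yes _ = s≤s (#≤length P? xs)
    ... | no _ = m≤n⇒m≤1+n (#≤length P? xs)
    step : ∀ {b} → Nbr W b → ¬ Nbr J b → Nbr K₁ b
    step n ¬n with Anyₚ.++⁻ J (Perm.Any-resp-↭ e n)
    ... | inj₁ m = contradiction m ¬n
    ... | inj₂ m = m
    onto-U₂ : ∀ V → # (nbr? W) (filter (¬? ∘ nbr? J) V) ≤ # (nbr? K₁) (filter (¬? ∘ nbr? J) V)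
    onto-U₂ [] = z≤n
    onto-U₂ (b ∷ V) with nbr? J b
    ... | yes _ = onto-U₂ V
    ... | no ¬n = +-mono-≤ (ind≤ (nbr? W b) (nbr? K₁ b) (λ n → step n ¬n)) (onto-U₂ V)

  -- The Halmos-Vaughan induction. If a proper nonempty sublist is tight, it is matched into its
  -- neighbours and its complement into the rest. Otherwise every such sublist has a neighbour to
  -- spare, and `x` may take any neighbour of its own.
  hall-fuel : ∀ n L U → length L ≤ n → HallCondition L U → Matching L U
  hall-fuel n [] U le hc = [] , U , [] , refl
  hall-fuel (suc n) (x ∷ L) U (s≤s le) hc with split? (tight? U) (x ∷ L)
  ... | yes (J , K , s , J≥1 , K≥1 , tight) =
    let us , us′ , pu , eu = hall-fuel n J (filter (nbr? J) U) |J|≤n (condition-left {U = U} hc s)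
        vs , vs′ , pv , ev = hall-fuel n K (filter (¬? ∘ nbr? J) U) |K|≤n (condition-right {U = U} hc s tight)
        ys , py , ey = pointwise-merge s pu pv
    in ys , us′ ++ vs′ , py , (begin
      U                                                     ↭⟨ filter-↭ (nbr? J) U ⟩
      filter (nbr? J) U ++ filter (¬? ∘ nbr? J) U           ↭⟨ Perm.++⁺ eu ev ⟩
      (us ++ us′) ++ (vs ++ vs′)                            ↭⟨ interchange us us′ vs vs′ ⟩
      (us ++ vs) ++ (us′ ++ vs′)                            ↭⟨ Perm.++⁺ʳ _ (↭-sym ey) ⟩
      ys ++ (us′ ++ vs′)                                    ∎)
    where
    open PermutationReasoning
    |L| : length J + length K ≤ suc n
    |L| = ≤-trans (≤-reflexive (split-length s)) (s≤s le)
    |J|≤n : length J ≤ n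
    |J|≤n = +-cancelʳ-≤ 1 (length J) n (≤-trans (+-monoʳ-≤ (length J) K≥1) (≤-trans |L| (≤-reflexive (+-comm 1 n))))
    |K|≤n : length K ≤ n
    |K|≤n = s≤s⁻¹ (≤-trans (+-monoˡ-≤ (length K) J≥1) |L|)
    interchange : ∀ (a b c d : List B) → (a ++ b) ++ (c ++ d) ↭ (a ++ c) ++ (b ++ d)
    interchange a b c d = begin
      (a ++ b) ++ (c ++ d)  ↭⟨ Perm.++-assoc a b (c ++ d) ⟩
      a ++ (b ++ (c ++ d))  ↭⟨ Perm.++⁺ˡ a (Perm.shifts b c) ⟩
      a ++ (c ++ (b ++ d))  ↭⟨ ↭-sym (Perm.++-assoc a c (b ++ d)) ⟩
      (a ++ c) ++ (b ++ d)  ∎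
  ... | no ¬tight with #-find (E? x) U (≤-trans (hc (left (split-none L))) (#-mono (nbr? (x ∷ [])) (E? x) U λ { (here e) → e }))
    where
    split-none : (xs : List A) → Split xs [] xs
    split-none [] = []
    split-none (x ∷ xs) = right (split-none xs)
  ...   | y , U′ , e , eU =
    let ys , zs , py , ey = hall-fuel n L U′ le hc′ in y ∷ ys , zs , e ∷ py , ↭-trans eU (prep y ey)
    where
    hc′ : HallCondition L U′
    hc′ {[]} s = z≤n
    hc′ {J@(_ ∷ _)} {K} s = s≤s⁻¹ (begin
      -- `x` lies in the complement, so `J` is proper and hence not tight; the loss of `y` is
      -- covered by the spare neighbour.
      suc (length J)                     ≤⟨ ≰⇒> (λ t → ¬tight (J , x ∷ K , right s , s≤s z≤n , s≤s z≤n , t)) ⟩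
      # (nbr? J) U                       ≡⟨ ∑-↭ _ eU ⟩
      ind (nbr? J y) + # (nbr? J) U′     ≤⟨ +-monoˡ-≤ _ (ind≤1 (nbr? J y)) ⟩
      suc (# (nbr? J) U′)                ∎)
      where
      open ≤-Reasoning
      ind≤1 : ∀ {P : Set} (d : Dec P) → ind d ≤ 1
      ind≤1 (yes _) = ≤-refl
      ind≤1 (no _) = z≤n

  hall : ∀ L U → HallCondition L U → Matching L U
  hall L U = hall-fuel (length L) L U ≤-refl

-- Routing along commuting steps

unique-↭ : ∀ {A : Set} {xs ys : List A} → xs ↭ ys → Unique xs → Unique ys
unique-↭ refl u = u
unique-↭ (prep x p) (x∉ ∷ u) = Perm.All-resp-↭ p x∉ ∷ unique-↭ p u
unique-↭ (swap x y p) ((x≢y ∷ x∉) ∷ (y∉ ∷ u)) =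
  ((λ e → x≢y (sym e)) ∷ Perm.All-resp-↭ p y∉) ∷ (Perm.All-resp-↭ p x∉ ∷ unique-↭ p u)
unique-↭ (transᵖ p q) u = unique-↭ q (unique-↭ p u)

unique-++ˡ : ∀ {A : Set} (xs : List A) {ys} → Unique (xs ++ ys) → Unique xs
unique-++ˡ [] u = []
unique-++ˡ (x ∷ xs) (x∉ ∷ u) = All.tabulate (λ y∈ → All.lookup x∉ (Anyₚ.++⁺ˡ y∈)) ∷ unique-++ˡ xs u

-- Instantiated below both with the steps and with the reversed steps, which exchanges Last and First.
module Layer {V G : Set} (U : List V) (U-unique : Unique U) (U-complete : ∀ v → v ∈ U) (gens : List G)
  (Step : G → V → V → Set) (step? : ∀ g x y → Dec (Step g x y)) (gens-complete : ∀ {g x y} → Step g x y → g ∈ gens)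
  (Reach : ℕ → V → V → Set) (reach? : ∀ k x y → Dec (Reach k x y))
  (step-functional : ∀ {g x y z} → Step g x y → Step g x z → y ≡ z)
  (reach-refl : ∀ {x} → Reach 0 x x) (reach-zero : ∀ {x y} → Reach 0 x y → x ≡ y)
  (reach-uncons : ∀ {k x z} → Reach (suc k) x z → ∃₂ λ g y → Step g x y × Reach k y z)
  (reach-snoc : ∀ {k g x y z} → Reach k x y → Step g y z → Reach (suc k) x z)
  (reach-push : ∀ {k g x y z} → Reach k x y → Step g y z → ∃ λ w → Step g x w × Reach k w z)
  where

  Edge : V → V → Set
  Edge x y = Any (λ g → Step g x y) gens

  edge? : ∀ x y → Dec (Edge x y)
  edge? x y = any? (λ g → step? g x y) gens

  Family : ℕ → List V → List V → Set
  Family k R S = Pointwise (Reach k) R S × Unique R × Unique S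

  -- The points visited just before the end (Last) or just after the start (First) by walks of
  -- length k + 1 from R to S.
  Last : ℕ → List V → List V → V → Set
  Last k R S v = Any (λ x → Reach k x v) R × Any (λ y → Edge v y) S

  last? : ∀ k R S → Decidable (Last k R S)
  last? k R S v = any? (λ x → reach? k x v) R ×-dec any? (λ y → edge? v y) S

  First : ℕ → List V → List V → V → Set
  First k R S v = Any (λ y → Reach k v y) S × Any (λ x → Edge x v) R

  first? : ∀ k R S → Decidable (First k R S)
  first? k R S v = any? (λ y → reach? k v y) S ×-dec any? (λ x → edge? x v) R

  LastLarge : ℕ → List V → List V → Set
  LastLarge k R S = length R ≤ # (last? k R S) U

  FirstLarge : ℕ → List V → List V → Set
  FirstLarge k R S = length S ≤ # (first? k R S) U

  -- Steps are counted with their generators, not as pairs of points. Commuting a step to the front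
  -- of a walk keeps its generator, and a generator determines at most one step from a given point,
  -- so the two counts can be compared generator by generator.
  outEdges inEdges : ℕ → List V → List V → ℕ
  outEdges k R S = ∑ (λ x → ∑ (λ g → # (λ v → step? g x v ×-dec any? (λ y → reach? k v y) S) U) gens) R
  inEdges k R S = ∑ (λ y → ∑ (λ g → # (λ v → step? g v y ×-dec any? (λ x → reach? k x v) R) U) gens) S

  -- The two complements may be empty, so the family itself is included.
  SubfamiliesLarge : ℕ → List V → List V → Set
  SubfamiliesLarge k R S = ∀ {R₁ R₂ S₁ S₂} → Split R R₁ R₂ → Split S S₁ S₂ → Family (suc k) R₁ S₁ → LastLarge k R₁ S₁

  last-base : ∀ {R S} → Family 1 R S → LastLarge 0 R S
  last-base {R} {S} (pw , uR , uS) = unique-length≤# (last? 0 R S) uR λ x∈ → U-complete _ , lose x∈ reach-refl , edge pw x∈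
    where
    edge : ∀ {R S x} → Pointwise (Reach 1) R S → x ∈ R → Any (Edge x) S
    edge (r ∷ _) (here refl) with reach-uncons r
    ... | g , y , s , z with reach-zero z
    ...   | refl = here (lose (gens-complete s) s)
    edge (_ ∷ pw) (there x∈) = there (edge pw x∈)

  -- Hall's condition for a part of the sources is `LastLarge` for the subfamily formed by this part
  -- and its own targets, whose last layer is contained in that of `R` and `S`.
  match-last : ∀ k {R S R₀ S₀} → (∀ {x} → x ∈ R₀ → x ∈ R) → (∀ {x} → x ∈ S₀ → x ∈ S) →
    Family (suc k) R₀ S₀ → SubfamiliesLarge k R₀ S₀ →
    ∃₂ λ ps zs → Pointwise (Reach k) R₀ ps × filter (last? k R S) U ↭ ps ++ zs
  match-last k {R} {S} {R₀} {S₀} R₀⊆R S₀⊆S (pw , uR , uS) large = hall R₀ (filter (last? k R S) U) condition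
    where
    open Hall (Reach k) (reach? k)
    open ≤-Reasoning
    condition : HallCondition R₀ (filter (last? k R S) U)
    condition {J} s with split-pointwise s pw
    ... | J′ , _ , s′ , pw′ = begin
      length J                                                     ≤⟨ large s s′ (pw′ , split-unique s uR , split-unique s′ uS) ⟩
      # (last? k J J′) U                                           ≡⟨ sym (#-filter (last? k J J′) (last? k R S) U sub) ⟩
      # (last? k J J′) (filter (last? k R S) U)                    ≤⟨ #-mono (last? k J J′) (nbr? J) (filter (last? k R S) U) proj₁ ⟩
      # (nbr? J) (filter (last? k R S) U)                          ∎
      where
      sub : ∀ {v} → Last k J J′ v → Last k R S v
      sub (a , b) =
        let x , x∈ , r = find a ; y , y∈ , e = find b
        in lose (R₀⊆R (split-∈ s x∈)) r , lose (S₀⊆S (split-∈ s′ y∈)) e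

  matched-∈ : ∀ {k R S ps zs p} → filter (last? k R S) U ↭ ps ++ zs → p ∈ ps → Last k R S p
  matched-∈ {k} {R} {S} e p∈ = proj₂ (∈-filter⁻ (last? k R S) {xs = U} (Perm.∈-resp-↭ (↭-sym e) (Anyₚ.++⁺ˡ p∈)))

  matched-family : ∀ {k R S R₀ ps zs} → Unique R₀ → Pointwise (Reach k) R₀ ps → filter (last? k R S) U ↭ ps ++ zs → Family k R₀ ps
  matched-family {k} {R} {S} {ps = ps} u pw e = pw , u , unique-++ˡ ps (unique-↭ e (Uniqueₚ.filter⁺ (last? k R S) U-unique))

  -- Matching the sources into the last layer shortens the walks by one step. The shorter family has
  -- a large first layer, and this is contained in the first layer of the original family because
  -- every matched point has a step into `S`.
  last⇒first : ∀ k {R S} → (∀ {R S} → Family (suc k) R S → FirstLarge k R S) →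
    Family (suc (suc k)) R S → SubfamiliesLarge (suc k) R S → FirstLarge (suc k) R S
  last⇒first k {R} {S} first fam@(pw , uR , uS) large with match-last (suc k) id id fam large
  ... | ps , zs , pw′ , e = begin
    length S                      ≡⟨ sym (Pointwise-length pw) ⟩
    length R                      ≡⟨ Pointwise-length pw′ ⟩
    length ps                     ≤⟨ first (matched-family uR pw′ e) ⟩
    # (first? k R ps) U           ≤⟨ #-mono (first? k R ps) (first? (suc k) R S) U sub ⟩
    # (first? (suc k) R S) U      ∎
    where
    open ≤-Reasoning
    sub : ∀ {v} → First k R ps v → First (suc k) R S v
    sub (a , b) =
      let p , p∈ , r = find a
          y , y∈ , ed = find (proj₂ (matched-∈ e p∈))
          g , _ , s = find ed
      in lose y∈ (reach-snoc r s) , b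

  -- If the last layer is too small, Hall's theorem matches all of it with the tail R of the sources.
  -- Since steps commute, a source has at least as many outgoing steps towards S as its partner,
  -- and x contributes at least one more.
  inEdges<outEdges : ∀ k {x y R S} → Family (suc k) (x ∷ R) (y ∷ S) → SubfamiliesLarge k R S →
    ¬ LastLarge k (x ∷ R) (y ∷ S) → inEdges k (x ∷ R) (y ∷ S) < outEdges k (x ∷ R) (y ∷ S)
  inEdges<outEdges k {x} {y} {R} {S} (r ∷ pw , _ ∷ uR , uyS@(_ ∷ uS)) large small
    with match-last k {x ∷ R} {y ∷ S} there there (pw , uR , uS) large
  ... | ps , zs , pw′ , e = begin-strict
    inEdges k (x ∷ R) (y ∷ S)                      ≡⟨ reorder ⟩
    ∑ into U                                       ≡⟨ ∑-filter (last? k (x ∷ R) (y ∷ S)) into U into-zero ⟩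
    ∑ into (filter (last? k (x ∷ R) (y ∷ S)) U)    ≡⟨ ∑-↭ into e ⟩
    ∑ into (ps ++ zs)                              ≡⟨ ∑-++ into ps zs ⟩
    ∑ into ps + ∑ into zs                          ≡⟨ cong (∑ into ps +_) (cong (∑ into) (empty zs zs≡[])) ⟩
    ∑ into ps + 0                                  ≡⟨ +-identityʳ _ ⟩
    ∑ into ps                                      ≤⟨ into≤out pw′ ⟩
    ∑ out R                                        <⟨ +-monoˡ-≤ (∑ out R) first-step ⟩
    out x + ∑ out R                                ∎
    where
    open ≤-Reasoning
    xR = x ∷ R
    yS = y ∷ S
    before : ∀ v → Dec (Any (λ x → Reach k x v) xR)
    before v = any? (λ x → reach? k x v) xR
    after : ∀ v → Dec (Any (λ y → Reach k v y) yS)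
    after v = any? (λ y → reach? k v y) yS
    into out : V → ℕ
    into v = ∑ (λ g → # (λ y → step? g v y ×-dec before v) yS) gens
    out x = ∑ (λ g → # (λ v → step? g x v ×-dec after v) U) gens
    reorder : inEdges k xR yS ≡ ∑ into U
    reorder = trans (∑-swap (λ y g → # (λ v → step? g v y ×-dec before v) U) yS gens)
      (trans (∑-cong gens (λ g → ∑-swap (λ y v → ind (step? g v y ×-dec before v)) yS U))
        (∑-swap (λ g v → # (λ y → step? g v y ×-dec before v) yS) gens U))
    into-zero : ∀ v → ¬ Last k xR yS v → into v ≡ 0
    into-zero v ¬l = trans (∑-cong gens λ g → #-zero (λ y → step? g v y ×-dec before v) yS
      (λ y∈ (s , b) → ¬l (b , lose y∈ (lose (gens-complete s) s)))) (∑-zero gens)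
    |zs|≡0 : length ps + length zs ≤ length ps + 0
    |zs|≡0 = begin
      length ps + length zs               ≡⟨ sym (length-++ ps) ⟩
      length (ps ++ zs)                   ≡⟨ sym (Perm.↭-length e) ⟩
      length (filter (last? k xR yS) U)   ≡⟨ length-filter≡# (last? k xR yS) U ⟩
      # (last? k xR yS) U                 ≤⟨ s≤s⁻¹ (≰⇒> small) ⟩
      length R                            ≡⟨ Pointwise-length pw′ ⟩
      length ps                           ≡⟨ sym (+-identityʳ _) ⟩
      length ps + 0                       ∎
    zs≡[] : length zs ≤ 0
    zs≡[] = +-cancelˡ-≤ (length ps) _ _ |zs|≡0
    empty : ∀ (zs : List V) → length zs ≤ 0 → zs ≡ []
    empty [] _ = refl
    into≤out : ∀ {R ps} → Pointwise (Reach k) R ps → ∑ into ps ≤ ∑ out R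
    into≤out [] = z≤n
    into≤out {x ∷ _} {p ∷ _} (r ∷ pw) = +-mono-≤
      (∑-mono gens λ g → #-≤-functional (λ y → step? g p y ×-dec before p) (λ v → step? g x v ×-dec after v) yS U uyS
        (λ (s , _) (t , _) → step-functional s t) λ y∈ (s , _) → let w , t , q = reach-push r s in w , U-complete w , t , lose y∈ q)
      (into≤out pw)
    first-step : 1 ≤ out x
    first-step with reach-uncons r
    ... | g , v , s , q = positive (gens-complete s)
      where
      positive : ∀ {gs} → g ∈ gs → 1 ≤ ∑ (λ g → # (λ v → step? g x v ×-dec after v) U) gs
      positive (here refl) = ≤-trans (#-positive (λ v → step? g x v ×-dec after v) (U-complete v) (s , here q)) (m≤m+n _ _)
      positive (there g∈) = ≤-trans (positive g∈) (m≤n+m _ _)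

-- Large layers and the size of cuts

module Routing {V G : Set} (_≟ᵛ_ : DecidableEquality V) (U : List V) (U-unique : Unique U) (U-complete : ∀ v → v ∈ U) (gens : List G)
  (Step : G → V → V → Set) (step? : ∀ g x y → Dec (Step g x y)) (gens-complete : ∀ {g x y} → Step g x y → g ∈ gens)
  (step-functional : ∀ {g x y z} → Step g x y → Step g x z → y ≡ z)
  (step-injective : ∀ {g x y z} → Step g x z → Step g y z → x ≡ y)
  (step-comm : ∀ {g h x y z} → Step g x y → Step h y z → ∃ λ w → Step h x w × Step g w z)
  where

  data Reach : ℕ → V → V → Set where
    []  : ∀ {x} → Reach 0 x x
    _∷_ : ∀ {k g x y z} → Step g x y → Reach k y z → Reach (suc k) x z

  reach? : ∀ k x y → Dec (Reach k x y)
  reach? zero x y with x ≟ᵛ y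
  ... | yes refl = yes []
  ... | no x≢y = no λ { [] → x≢y refl }
  reach? (suc k) x z = map′ to from (any? (λ g → any? (λ y → step? g x y ×-dec reach? k y z) U) gens)
    where
    to : Any (λ g → Any (λ y → Step g x y × Reach k y z) U) gens → Reach (suc k) x z
    to a = let g , _ , b = find a ; y , _ , s , r = find b in s ∷ r
    from : Reach (suc k) x z → Any (λ g → Any (λ y → Step g x y × Reach k y z) U) gens
    from (s ∷ r) = lose (gens-complete s) (lose (U-complete _) (s , r))

  reach-zero : ∀ {x y} → Reach 0 x y → x ≡ y
  reach-zero [] = refl

  reach-uncons : ∀ {k x z} → Reach (suc k) x z → ∃₂ λ g y → Step g x y × Reach k y z
  reach-uncons (s ∷ r) = _ , _ , s , r

  reach-snoc : ∀ {k g x y z} → Reach k x y → Step g y z → Reach (suc k) x z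
  reach-snoc [] s = s ∷ []
  reach-snoc (t ∷ r) s = t ∷ reach-snoc r s

  reach-push : ∀ {k g x y z} → Reach k x y → Step g y z → ∃ λ w → Step g x w × Reach k w z
  reach-push [] s = _ , s , []
  reach-push (t ∷ r) s =
    let w , s′ , r′ = reach-push r s ; v , s″ , t′ = step-comm t s′ in v , s″ , t′ ∷ r′

  reach-pull : ∀ {k g x y z} → Step g x y → Reach k y z → ∃ λ w → Step g w z × Reach k x w
  reach-pull s [] = _ , s , []
  reach-pull s (t ∷ r) =
    let v , t′ , s′ = step-comm s t ; w , s″ , r′ = reach-pull s′ r in w , s″ , t′ ∷ r′

  reach-unsnoc : ∀ {k x z} → Reach (suc k) x z → ∃₂ λ g y → Step g y z × Reach k x y
  reach-unsnoc (s ∷ r) = let w , s′ , r′ = reach-pull s r in _ , w , s′ , r′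

  module Fwd = Layer U U-unique U-complete gens Step step? gens-complete Reach reach?
    step-functional [] reach-zero reach-uncons reach-snoc reach-push

  module Bwd = Layer U U-unique U-complete gens (λ g x y → Step g y x) (λ g x y → step? g y x) gens-complete
    (λ k x y → Reach k y x) (λ k x y → reach? k y x)
    step-injective [] (sym ∘ reach-zero) reach-unsnoc (flip _∷_) (flip reach-pull)

  open DecMembership _≟ᵛ_ using (_∈?_)
  open Fwd using (Family; LastLarge; FirstLarge; SubfamiliesLarge)

  reverse-family : ∀ {k R S} → Family k R S → Bwd.Family k S R
  reverse-family (pw , uR , uS) = Pointwise.symmetric id pw , uS , uR

  reverse-family⁻ : ∀ {k R S} → Bwd.Family k S R → Family k R S
  reverse-family⁻ (pw , uS , uR) = Pointwise.symmetric id pw , uR , uS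

  family-length : ∀ {k R S} → Family k R S → length R ≡ length S
  family-length (pw , _) = Pointwise-length pw

  BothLarge : ℕ → List V → List V → Set
  BothLarge k R S = LastLarge k R S × FirstLarge k R S

  -- Two sublists of equal length are either the whole lists or strictly shorter, since an empty
  -- complement on one side forces one on the other. Thus the induction on the length together with
  -- the case of the whole family covers all subfamilies.
  subfamilies-bounded : ∀ {m} {R S : List V} {Q : List V → List V → Set} →
    (∀ {R S} → length R ≡ length S → length R ≤ m → Q R S) → length R ≤ suc m → length R ≡ length S → Q R S →
    ∀ {R₁ R₂ S₁ S₂} → Split R R₁ R₂ → Split S S₁ S₂ → length R₁ ≡ length S₁ → Q R₁ S₁
  subfamilies-bounded {m} {R} {S} {Q} below le eq whole {R₁} {[]} {S₁} {[]} s t e =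
    subst₂ Q (sym (split-all⁻ s)) (sym (split-all⁻ t)) whole
  subfamilies-bounded {m} {R} {S} {Q} below le eq whole {R₁} {[]} {S₁} {z ∷ S₂} s t e =
    contradiction (begin-strict
      length S₁                       <⟨ m<m+n (length S₁) (s≤s z≤n) ⟩
      length S₁ + length (z ∷ S₂)     ≡⟨ split-length t ⟩
      length S                        ≡⟨ sym eq ⟩
      length R                        ≡⟨ cong length (sym (split-all⁻ s)) ⟩
      length R₁                       ≡⟨ e ⟩
      length S₁                       ∎) (<-irrefl refl)
    where open ≤-Reasoning
  subfamilies-bounded {m} {R} below le eq whole {R₁} {z ∷ R₂} s t e =
    below e (s≤s⁻¹ (begin
      suc (length R₁)                 ≤⟨ m<m+n (length R₁) (s≤s z≤n) ⟩
      length R₁ + length (z ∷ R₂)     ≡⟨ split-length s ⟩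
      length R                        ≤⟨ le ⟩
      suc m                           ∎))
    where open ≤-Reasoning

  -- If both layers were too small, inEdges<outEdges and its mirror image would contradict each other;
  -- and one large layer makes the other large, by rematching and the induction on the length.
  both-large-suc : ∀ k → (∀ {R S} → Family (suc k) R S → BothLarge k R S) →
    ∀ m {R S} → Family (suc (suc k)) R S → length R ≤ m → BothLarge (suc k) R S
  both-large-suc k previous m {[]} ([] , _) le = z≤n , z≤n
  both-large-suc k previous (suc m) {x ∷ R} {y ∷ S} fam le = decide (length xR ≤? # (Fwd.last? (suc k) xR yS) U)
                                                           (length yS ≤? # (Fwd.first? (suc k) xR yS) U)
    where
    xR = x ∷ R
    yS = y ∷ S

    smaller : ∀ {R S} → Family (suc (suc k)) R S → length R ≤ m → BothLarge (suc k) R S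
    smaller = both-large-suc k previous m

    smaller-tail : ∀ {R₁ R₂} → Split R R₁ R₂ → length R₁ ≤ m
    smaller-tail {R₁} s = ≤-trans (m≤m+n (length R₁) _) (≤-trans (≤-reflexive (split-length s)) (s≤s⁻¹ le))

    fwd : LastLarge (suc k) xR yS → FirstLarge (suc k) xR yS
    fwd large = Fwd.last⇒first k (λ f → proj₂ (previous f)) fam
      (λ s t f → subfamilies-bounded {Q = λ R S → Family (suc (suc k)) R S → LastLarge (suc k) R S}
        (λ _ le f → proj₁ (smaller f le)) le (family-length fam) (λ _ → large) s t (family-length f) f)

    bwd : FirstLarge (suc k) xR yS → LastLarge (suc k) xR yS
    bwd large = Bwd.last⇒first k (λ f → proj₁ (previous (reverse-family⁻ f))) (reverse-family fam)
      (λ s t f → subfamilies-bounded {Q = λ S R → Bwd.Family (suc (suc k)) S R → FirstLarge (suc k) R S}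
        (λ e le f → proj₂ (smaller (reverse-family⁻ f) (≤-trans (≤-reflexive (sym e)) le)))
        (≤-trans (≤-reflexive (sym (family-length fam))) le) (sym (family-length fam)) (λ _ → large) s t
        (sym (family-length (reverse-family⁻ f))) f)

    decide : Dec (LastLarge (suc k) xR yS) → Dec (FirstLarge (suc k) xR yS) → BothLarge (suc k) xR yS
    decide (yes p) _ = p , fwd p
    decide (no _) (yes q) = bwd q , q
    -- Reversing the steps exchanges `inEdges` and `outEdges` by definition, so the two strict
    -- inequalities are opposite.
    decide (no ¬p) (no ¬q) = contradiction
      (Fwd.inEdges<outEdges (suc k) fam (λ s t f → proj₁ (smaller f (smaller-tail s))) ¬p)
      (<-asym (Bwd.inEdges<outEdges (suc k) (reverse-family fam)
        (λ s t f → let f′ = reverse-family⁻ f in proj₂ (smaller f′ (smaller-tail t))) ¬q))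

  both-large : ∀ k {R S} → Family (suc k) R S → BothLarge k R S
  both-large zero fam = Fwd.last-base fam , Bwd.last-base (reverse-family fam)
  both-large (suc k) fam = both-large-suc k (both-large k) _ fam ≤-refl

  data Avoids (C : List V) : ℕ → V → V → Set where
    [_] : ∀ {x} → x ∉ C → Avoids C 0 x x
    _∷_ : ∀ {k g x y z} → x ∉ C × Step g x y → Avoids C k y z → Avoids C (suc k) x z

  avoids-snoc : ∀ {C k g x y z} → Avoids C k x y → Step g y z → z ∉ C → Avoids C (suc k) x z
  avoids-snoc [ n ] s z∉ = (n , s) ∷ [ z∉ ]
  avoids-snoc (t ∷ a) s z∉ = t ∷ avoids-snoc a s z∉

  -- Targets in `C` number at most `length C`. For the other pairs, matching the sources into the
  -- last layer gives targets one step earlier; an avoiding walk to one of these would extend to an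
  -- avoiding walk into `S`, so the new family is blocked too and has length `k`.
  cut-size : ∀ k C {R S} → Family k R S → (∀ {x y} → x ∈ R → y ∈ S → ¬ Avoids C k x y) → length R ≤ suc k * length C
  cut-size zero C {R} (pw , uR , uS) blocked = ≤-trans (unique-length≤ uR inC) (≤-reflexive (sym (+-identityʳ _)))
    where
    same : ∀ {R S x} → Pointwise (Reach 0) R S → x ∈ R → x ∈ S
    same ([] ∷ _) (here refl) = here refl
    same (_ ∷ pw) (there x∈) = there (same pw x∈)
    inC : ∀ {x} → x ∈ R → x ∈ C
    inC {x} x∈ with x ∈? C
    ... | yes p = p
    ... | no ¬p = contradiction [ ¬p ] (blocked x∈ (same pw x∈))
  cut-size (suc k) C {R} {S} fam@(pw , uR , uS) blocked with partition pw uR uS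
    where
    partition : ∀ {R S} → Pointwise (Reach (suc k)) R S → Unique R → Unique S →
      Σ (List V) λ R₁ → ∃ λ S₁ → ∃ λ D → (∃ (Split R R₁)) × Split S S₁ D × Pointwise (Reach (suc k)) R₁ S₁ ×
        All (_∉ C) S₁ × (∀ {y} → y ∈ D → y ∈ C) × length R ≡ length D + length R₁
    partition [] _ _ = [] , [] , [] , ([] , []) , [] , [] , [] , (λ ()) , refl
    partition {x ∷ R} {y ∷ S} (r ∷ pw) (_ ∷ uR) (y∉ ∷ uS) with partition pw uR uS | y ∈? C
    ... | R₁ , S₁ , D , (R₂ , s) , t , pw₁ , out , inn , eq | yes y∈ =
      R₁ , S₁ , y ∷ D , (x ∷ R₂ , right s) , right t , pw₁ , out , (λ { (here refl) → y∈ ; (there p) → inn p }) , cong suc eq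
    ... | R₁ , S₁ , D , (R₂ , s) , t , pw₁ , out , inn , eq | no y∉C =
      x ∷ R₁ , y ∷ S₁ , D , (R₂ , left s) , left t , r ∷ pw₁ , y∉C ∷ out , inn , trans (cong suc eq) (sym (+-suc (length D) _))
  ... | R₁ , S₁ , D , (_ , s) , t , pw₁ , out , inn , eq
    with Fwd.match-last k id id (pw₁ , split-unique s uR , split-unique t uS) (λ _ _ f → proj₁ (both-large k f))
  ...   | ps , zs , pw′ , e = begin
    length R                     ≡⟨ eq ⟩
    length D + length R₁         ≤⟨ +-mono-≤ (unique-length≤ uD inn) (cut-size k C (Fwd.matched-family (split-unique s uR) pw′ e) blocked′) ⟩
    length C + suc k * length C  ∎
    where
    open ≤-Reasoning
    split-flip : ∀ {xs ys zs : List V} → Split xs ys zs → Split xs zs ys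
    split-flip [] = []
    split-flip (left s) = right (split-flip s)
    split-flip (right s) = left (split-flip s)
    uD = split-unique (split-flip t) uS
    blocked′ : ∀ {x p} → x ∈ R₁ → p ∈ ps → ¬ Avoids C k x p
    blocked′ x∈ p∈ a with find (proj₂ (Fwd.matched-∈ e p∈))
    ... | y , y∈ , ed with find ed
    ...   | g , _ , st = blocked (split-∈ s x∈) (split-∈ t y∈) (avoids-snoc a st (All.lookup out y∈))

-- Sorting a line

data Paired {V : Set} (R : ℕ → V → V → Set) : ℕ → List V → List V → Set where
  []  : Paired R 0 [] []
  _∷_ : ∀ {ℓ c x y xs ys} → R ℓ x y → Paired R c xs ys → Paired R (ℓ + c) (x ∷ xs) (y ∷ ys)

-- The targets matter only up to permutation, so this is a bijection of multisets together with its
-- total cost.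
Transport : {V : Set} (R : ℕ → V → V → Set) → ℕ → List V → List V → Set
Transport R c xs ys = ∃ λ zs → Paired R c xs zs × zs ↭ ys

module _ {V : Set} {R : ℕ → V → V → Set} where

  paired-cast : ∀ {c c′ xs ys} → c ≡ c′ → Paired R c xs ys → Paired R c′ xs ys
  paired-cast refl p = p

  transport-cast : ∀ {c c′ xs ys} → c ≡ c′ → Transport R c xs ys → Transport R c′ xs ys
  transport-cast refl t = t

  paired-↭ : ∀ {c xs ys ws} → xs ↭ ys → Paired R c ys ws → Transport R c xs ws
  paired-↭ refl p = _ , p , refl
  paired-↭ (prep x e) (r ∷ p) = let zs , q , e′ = paired-↭ e p in _ , r ∷ q , prep _ e′
  paired-↭ (swap x y e) (_∷_ {ℓ} {y = u} r (_∷_ {ℓ′} {c} {y = v} s p)) =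
    let zs , q , e′ = paired-↭ e p
    in _ , paired-cast (commute ℓ′ ℓ c) (s ∷ (r ∷ q)) , swap v u e′
    where
    commute : ∀ a b c → a + (b + c) ≡ b + (a + c)
    commute a b c = trans (sym (+-assoc a b c)) (trans (cong (_+ c) (+-comm a b)) (+-assoc b a c))
  paired-↭ (transᵖ e f) p =
    let zs , q , e′ = paired-↭ f p ; ws , q′ , e″ = paired-↭ e q in ws , q′ , ↭-trans e″ e′

  transport-↭ˡ : ∀ {c xs ys ws} → xs ↭ ys → Transport R c ys ws → Transport R c xs ws
  transport-↭ˡ e (zs , p , f) = let us , q , g = paired-↭ e p in us , q , ↭-trans g f

  transport-↭ʳ : ∀ {c xs ys ws} → Transport R c xs ys → ys ↭ ws → Transport R c xs ws
  transport-↭ʳ (zs , p , f) e = zs , p , ↭-trans f e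

  transport-++ : ∀ {c c′ xs xs′ ys ys′} → Transport R c xs ys → Transport R c′ xs′ ys′ → Transport R (c + c′) (xs ++ xs′) (ys ++ ys′)
  transport-++ (zs , p , e) (zs′ , p′ , e′) = zs ++ zs′ , append p p′ , Perm.++⁺ e e′
    where
    append : ∀ {c c′ xs xs′ ys ys′} → Paired R c xs ys → Paired R c′ xs′ ys′ → Paired R (c + c′) (xs ++ xs′) (ys ++ ys′)
    append [] q = q
    append (_∷_ {ℓ} {c} r p) q = paired-cast (sym (+-assoc ℓ c _)) (r ∷ append p q)

  transport-trans : (∀ {a b x y z} → R a x y → R b y z → R (a + b) x z) →
    ∀ {c c′ xs ys zs} → Transport R c xs ys → Transport R c′ ys zs → Transport R (c + c′) xs zs
  transport-trans R-trans (us , p , e) t = let vs , q , f = transport-↭ˡ e t in vs , compose p q , f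
    where
    compose : ∀ {c c′ xs ys zs} → Paired R c xs ys → Paired R c′ ys zs → Paired R (c + c′) xs zs
    compose [] [] = []
    compose (_∷_ {ℓ} {c} r p) (_∷_ {ℓ′} {c′} s q) =
      paired-cast (+-interchange ℓ ℓ′ c c′) (R-trans r s ∷ compose p q)

  transport-refl : (∀ {x} → R 0 x x) → ∀ xs → Transport R 0 xs xs
  transport-refl R-refl xs = xs , same xs , refl
    where
    same : ∀ xs → Paired R 0 xs xs
    same [] = []
    same (x ∷ xs) = R-refl ∷ same xs

  transport-map₂ : ∀ {A : Set} {ℓ} (φ ψ : A → V) → (∀ x → R ℓ (φ x) (ψ x)) → ∀ xs → Transport R (length xs * ℓ) (map φ xs) (map ψ xs)
  transport-map₂ φ ψ r xs = map ψ xs , pairs xs , refl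
    where
    pairs : ∀ xs → Paired R (length xs * _) (map φ xs) (map ψ xs)
    pairs [] = []
    pairs (x ∷ xs) = r x ∷ pairs xs

transport-map : ∀ {V W : Set} {R : ℕ → V → V → Set} {Q : ℕ → W → W → Set} (φ : V → W) →
  (∀ {ℓ x y} → R ℓ x y → Q ℓ (φ x) (φ y)) → ∀ {c xs ys} → Transport R c xs ys → Transport Q c (map φ xs) (map φ ys)
transport-map {R = R} {Q} φ f (zs , p , e) = map φ zs , go p , Perm.map⁺ φ e
  where
  go : ∀ {c xs ys} → Paired R c xs ys → Paired Q c (map φ xs) (map φ ys)
  go [] = []
  go (r ∷ p) = f r ∷ go p

-- Climbs by powers of two and the cost of a merge

data Climb : ℕ → ℕ → ℕ → Set where
  []   : ∀ {x} → Climb 0 x x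
  step : ∀ {ℓ x y z} a → y ≡ x + 2 ^ a → Climb ℓ y z → Climb (suc ℓ) x z

climb-trans : ∀ {k l x y z} → Climb k x y → Climb l y z → Climb (k + l) x z
climb-trans [] q = q
climb-trans (step a e p) q = step a e (climb-trans p q)

climb-+ : ∀ {k x y} m → Climb k x y → Climb k (x + m) (y + m)
climb-+ m [] = []
climb-+ {x = x} m (step a refl p) = step a (shuffle x (2 ^ a) m) (climb-+ m p)
  where
  shuffle : ∀ a b c → (a + b) + c ≡ (a + c) + b
  shuffle a b c = trans (+-assoc a b c) (trans (cong (a +_) (+-comm b c)) (sym (+-assoc a c b)))

dbl : ℕ → ℕ
dbl zero = zero
dbl (suc n) = suc (suc (dbl n))

dbl≡ : ∀ n → dbl n ≡ n + n
dbl≡ zero = refl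
dbl≡ (suc n) = cong suc (trans (cong suc (dbl≡ n)) (sym (+-suc n n)))

dbl-+ : ∀ m n → dbl (m + n) ≡ dbl m + dbl n
dbl-+ zero n = refl
dbl-+ (suc m) n = cong (suc ∘ suc) (dbl-+ m n)

dbl-2^ : ∀ a → dbl (2 ^ a) ≡ 2 ^ suc a
dbl-2^ a = trans (dbl≡ (2 ^ a)) (cong (2 ^ a +_) (sym (+-identityʳ _)))

-- A step 2^a becomes a step 2^(a+1). Hence the even positions, and after a shift by one the odd
-- positions, behave like a line of half the length at no extra cost.
climb-dbl : ∀ {k x y} → Climb k x y → Climb k (dbl x) (dbl y)
climb-dbl [] = []
climb-dbl {x = x} (step a refl p) = step (suc a) (trans (dbl-+ x (2 ^ a)) (cong (dbl x +_) (dbl-2^ a))) (climb-dbl p)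

climb-suc : ∀ {k x y} → Climb k x y → Climb k (suc x) (suc y)
climb-suc [] = []
climb-suc (step a e p) = step a (cong suc e) (climb-suc p)

odd : ℕ → ℕ
odd = suc ∘ dbl

downFrom-suc : ∀ n → downFrom (suc n) ↭ 0 ∷ map suc (downFrom n)
downFrom-suc zero = refl
downFrom-suc (suc n) = ↭-trans (prep (suc n) (downFrom-suc n)) (swap _ _ refl)

downFrom-+ : ∀ m n → downFrom (m + n) ≡ map (_+ n) (downFrom m) ++ downFrom n
downFrom-+ zero n = refl
downFrom-+ (suc m) n = cong (m + n ∷_) (downFrom-+ m n)

downFrom-dbl : ∀ n → downFrom (dbl n) ↭ map dbl (downFrom n) ++ map odd (downFrom n)
downFrom-dbl zero = refl
downFrom-dbl (suc n) = begin
  odd n ∷ dbl n ∷ downFrom (dbl n)                                    ↭⟨ swap _ _ (downFrom-dbl n) ⟩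
  dbl n ∷ odd n ∷ (map dbl (downFrom n) ++ map odd (downFrom n))      ↭⟨ prep _ (↭-sym (Perm.shift (odd n) (map dbl (downFrom n)) _)) ⟩
  dbl n ∷ map dbl (downFrom n) ++ odd n ∷ map odd (downFrom n)        ∎
  where open PermutationReasoning

-- A power of two from 2 on comes out as 2^i + 2^i, with `r` at its maximum. What counts later is
-- that `r` is at most 2^i and smaller than the number that is decomposed.
binary-leading : ∀ b → ∃₂ λ i r → suc b ≡ r + 2 ^ i × r ≤ 2 ^ i
binary-leading zero = 0 , 0 , refl , z≤n
binary-leading (suc b) with binary-leading b
... | i , r , e , r≤ with r ≟ 2 ^ i
...   | no r≢ = i , suc r , cong suc e , ≤∧≢⇒< r≤ r≢
...   | yes refl = suc i , 1 , cong suc (trans e (cong (2 ^ i +_) (sym (+-identityʳ _)))) , m^n>0 2 (suc i)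

Moves : ℕ → List ℕ → List ℕ → Set
Moves = Transport Climb

Moves≤ : ℕ → List ℕ → List ℕ → Set
Moves≤ b xs ys = ∃ λ c → Moves c xs ys × c ≤ b

-- With h = 2^j, the odd positions below 2h stay where they are, and the even position 2x goes to
-- 2(x + h) + 1 by a step 2h and a step 1. That is two steps for each of h positions.
spread-2^ : ∀ i → Moves≤ (2 ^ i) (downFrom (2 ^ i)) (map odd (downFrom (2 ^ i)))
spread-2^ zero = 1 , (_ , step 0 refl [] ∷ [] , refl) , ≤-refl
spread-2^ (suc j) = h * 2 + 0 ,
    transport-↭ˡ source (transport-↭ʳ (transport-++ up (transport-refl [] (map odd (downFrom h)))) target) ,
    ≤-reflexive (trans (+-identityʳ _) (*-comm h 2))
  where
  h = 2 ^ j
  2h : h + (h + 0) ≡ h + h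
  2h = cong (h +_) (+-identityʳ h)
  up : Moves (h * 2) (map dbl (downFrom h)) (map (odd ∘ (_+ h)) (downFrom h))
  up = transport-cast (cong (_* 2) (length-downFrom h))
    (transport-map₂ dbl (odd ∘ (_+ h)) (λ x → step (suc j) (trans (dbl-+ x h) (cong (dbl x +_) (dbl-2^ j))) (step 0 (+-comm 1 _) [])) (downFrom h))
  source : downFrom (2 ^ suc j) ↭ map dbl (downFrom h) ++ map odd (downFrom h)
  source = ↭-trans (↭-reflexive (cong downFrom (sym (dbl-2^ j)))) (downFrom-dbl h)
  target : map (odd ∘ (_+ h)) (downFrom h) ++ map odd (downFrom h) ↭ map odd (downFrom (2 ^ suc j))
  target = ↭-reflexive (begin
    map (odd ∘ (_+ h)) (downFrom h) ++ map odd (downFrom h)         ≡⟨ cong (_++ map odd (downFrom h)) (map-∘ (downFrom h)) ⟩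
    map odd (map (_+ h) (downFrom h)) ++ map odd (downFrom h)       ≡⟨ sym (map-++ odd (map (_+ h) (downFrom h)) (downFrom h)) ⟩
    map odd (map (_+ h) (downFrom h) ++ downFrom h)                 ≡⟨ cong (map odd) (sym (downFrom-+ h h)) ⟩
    map odd (downFrom (h + h))                                      ≡⟨ cong (map odd ∘ downFrom) (sym 2h) ⟩
    map odd (downFrom (2 ^ suc j))                                  ∎)
    where open ≡-Reasoning

-- Write b = r + 2^i with r ≤ 2^i.  The top r positions first jump by 2^i, after which both parts
-- are smaller instances; the total is at most 2^i + r + 2r ≤ 2b.
spread-fuel : ∀ n b → b ≤ n → Moves≤ (2 * b) (downFrom b) (map odd (downFrom b))
spread-fuel n zero le = 0 , ([] , [] , refl) , z≤n
spread-fuel (suc n) (suc b) (s≤s le) with binary-leading b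
... | i , r , e , r≤p with spread-2^ i | spread-fuel n r (≤-trans r≤b le)
  where
  r≤b : r ≤ b
  r≤b = s≤s⁻¹ (≤-trans (≤-reflexive (+-comm 1 r)) (≤-trans (+-monoʳ-≤ r (m^n>0 2 i)) (≤-reflexive (sym e))))
...   | c , t , c≤ | c′ , t′ , c′≤ =
    (r * 1 + c′) + c ,
    subst (λ b → Moves ((r * 1 + c′) + c) (downFrom b) (map odd (downFrom b))) (sym e)
      (transport-↭ˡ (↭-reflexive (downFrom-+ r p)) (transport-↭ʳ (transport-++ (transport-trans climb-trans hop t″) t) target)) ,
    subst (λ b → (r * 1 + c′) + c ≤ 2 * b) (sym e) bound
  where
  p = 2 ^ i
  hop : Moves (r * 1) (map (_+ p) (downFrom r)) (map (_+ dbl p) (downFrom r))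
  hop = transport-cast (cong (_* 1) (length-downFrom r))
    (transport-map₂ (_+ p) (_+ dbl p) (λ x → step i (trans (cong (x +_) (dbl≡ p)) (sym (+-assoc x p p))) []) (downFrom r))
  t″ : Moves c′ (map (_+ dbl p) (downFrom r)) (map (_+ dbl p) (map odd (downFrom r)))
  t″ = transport-map (_+ dbl p) (climb-+ (dbl p)) t′
  target : map (_+ dbl p) (map odd (downFrom r)) ++ map odd (downFrom p) ↭ map odd (downFrom (r + p))
  target = ↭-reflexive (begin
    map (_+ dbl p) (map odd (downFrom r)) ++ map odd (downFrom p)   ≡⟨ cong (_++ _) (sym (map-∘ (downFrom r))) ⟩
    map (λ x → odd x + dbl p) (downFrom r) ++ map odd (downFrom p)  ≡⟨ cong (_++ _) (map-cong (λ x → cong suc (sym (dbl-+ x p))) (downFrom r)) ⟩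
    map (λ x → odd (x + p)) (downFrom r) ++ map odd (downFrom p)    ≡⟨ cong (_++ _) (map-∘ (downFrom r)) ⟩
    map odd (map (_+ p) (downFrom r)) ++ map odd (downFrom p)       ≡⟨ sym (map-++ odd (map (_+ p) (downFrom r)) (downFrom p)) ⟩
    map odd (map (_+ p) (downFrom r) ++ downFrom p)                 ≡⟨ cong (map odd) (sym (downFrom-+ r p)) ⟩
    map odd (downFrom (r + p))                                      ∎)
    where open ≡-Reasoning
  bound : (r * 1 + c′) + c ≤ 2 * (r + p)
  bound = begin
    (r * 1 + c′) + c            ≤⟨ +-mono-≤ (+-mono-≤ (≤-reflexive (*-identityʳ r)) c′≤) c≤ ⟩
    (r + 2 * r) + p             ≤⟨ +-monoˡ-≤ p (+-monoˡ-≤ (2 * r) r≤p) ⟩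
    (p + 2 * r) + p             ≡⟨ cong (_+ p) (+-comm p (2 * r)) ⟩
    (2 * r + p) + p             ≡⟨ +-assoc (2 * r) p p ⟩
    2 * r + (p + p)             ≡⟨ cong (λ z → 2 * r + (p + z)) (sym (+-identityʳ p)) ⟩
    2 * r + 2 * p               ≡⟨ sym (*-distribˡ-+ 2 r p) ⟩
    2 * (r + p)                 ∎
    where open ≤-Reasoning

spread : ∀ b → Moves≤ (2 * b) (downFrom b) (map odd (downFrom b))
spread b = spread-fuel b b ≤-refl

-- The even positions hold a sorted tokens and the odd ones b; without position 0 the two roles are
-- exchanged.  The hypotheses say t ≥ b - a and t ≥ a - b - 1.
interleave : ∀ a b t → b ≤ a + t → a ≤ suc (b + t) →
  Moves≤ (2 * t) (downFrom (a + b)) (map dbl (downFrom a) ++ map odd (downFrom b))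
interleave zero b t b≤ _ = let c , m , c≤ = spread b in c , m , ≤-trans c≤ (*-monoʳ-≤ 2 b≤)
interleave (suc a) b t b≤ (s≤s a≤) with interleave b a t a≤ b≤
... | c , m , c≤ = c , transport-↭ˡ source (transport-↭ʳ (transport-++ (transport-refl [] (0 ∷ [])) (transport-map suc climb-suc m)) target) , c≤
  where
  source : downFrom (suc a + b) ↭ 0 ∷ map suc (downFrom (b + a))
  source = ↭-trans (↭-reflexive (cong (downFrom ∘ suc) (+-comm a b))) (downFrom-suc (b + a))
  open PermutationReasoning
  target : 0 ∷ map suc (map dbl (downFrom b) ++ map odd (downFrom a)) ↭ map dbl (downFrom (suc a)) ++ map odd (downFrom b)
  target = begin
    0 ∷ map suc (map dbl (downFrom b) ++ map odd (downFrom a))            ≡⟨ cong (0 ∷_) (map-++ suc (map dbl (downFrom b)) _) ⟩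
    0 ∷ map suc (map dbl (downFrom b)) ++ map suc (map odd (downFrom a))  ≡⟨ cong₂ (λ u v → 0 ∷ u ++ v) (sym (map-∘ (downFrom b))) (trans (sym (map-∘ (downFrom a))) (map-∘ (downFrom a))) ⟩
    0 ∷ map odd (downFrom b) ++ map dbl (map suc (downFrom a))            ↭⟨ prep 0 (Perm.++-comm (map odd (downFrom b)) _) ⟩
    map dbl (0 ∷ map suc (downFrom a)) ++ map odd (downFrom b)            ↭⟨ Perm.++⁺ʳ _ (Perm.map⁺ dbl (↭-sym (downFrom-suc a))) ⟩
    map dbl (downFrom (suc a)) ++ map odd (downFrom b)                    ∎

bit : Bool → ℕ
bit true = 1
bit false = 0

count : {A : Set} → (A → Bool) → List A → ℕ
count h = ∑ (bit ∘ h)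

filterᵇ-map : ∀ {A B : Set} (h : B → Bool) (φ : A → B) xs → filterᵇ h (map φ xs) ≡ map φ (filterᵇ (h ∘ φ) xs)
filterᵇ-map h φ [] = refl
filterᵇ-map h φ (x ∷ xs) with h (φ x)
... | true = cong (φ x ∷_) (filterᵇ-map h φ xs)
... | false = filterᵇ-map h φ xs

filterᵇ-++ : ∀ {A : Set} (h : A → Bool) xs ys → filterᵇ h (xs ++ ys) ≡ filterᵇ h xs ++ filterᵇ h ys
filterᵇ-++ h [] ys = refl
filterᵇ-++ h (x ∷ xs) ys with h x
... | true = cong (x ∷_) (filterᵇ-++ h xs ys)
... | false = filterᵇ-++ h xs ys

filterᵇ-↭ : ∀ {A : Set} (h : A → Bool) {xs ys} → xs ↭ ys → filterᵇ h xs ↭ filterᵇ h ys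
filterᵇ-↭ h refl = refl
filterᵇ-↭ h (prep x e) with h x
... | true = prep x (filterᵇ-↭ h e)
... | false = filterᵇ-↭ h e
filterᵇ-↭ h {_ ∷ _ ∷ xs} {_ ∷ _ ∷ ys} (swap x y e) = begin
  filterᵇ h (x ∷ y ∷ xs)                                          ≡⟨ filterᵇ-++ h (x ∷ []) (y ∷ xs) ⟩
  filterᵇ h (x ∷ []) ++ filterᵇ h (y ∷ xs)                        ≡⟨ cong (filterᵇ h (x ∷ []) ++_) (filterᵇ-++ h (y ∷ []) xs) ⟩
  filterᵇ h (x ∷ []) ++ filterᵇ h (y ∷ []) ++ filterᵇ h xs        ↭⟨ Perm.shifts (filterᵇ h (x ∷ [])) (filterᵇ h (y ∷ [])) ⟩
  filterᵇ h (y ∷ []) ++ filterᵇ h (x ∷ []) ++ filterᵇ h xs        ↭⟨ Perm.++⁺ˡ (filterᵇ h (y ∷ [])) (Perm.++⁺ˡ (filterᵇ h (x ∷ [])) (filterᵇ-↭ h e)) ⟩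
  filterᵇ h (y ∷ []) ++ filterᵇ h (x ∷ []) ++ filterᵇ h ys        ≡⟨ cong (filterᵇ h (y ∷ []) ++_) (filterᵇ-++ h (x ∷ []) ys) ⟨
  filterᵇ h (y ∷ []) ++ filterᵇ h (x ∷ ys)                        ≡⟨ filterᵇ-++ h (y ∷ []) (x ∷ ys) ⟨
  filterᵇ h (y ∷ x ∷ ys)                                          ∎
  where open PermutationReasoning
filterᵇ-↭ h (transᵖ e f) = ↭-trans (filterᵇ-↭ h e) (filterᵇ-↭ h f)

inversion : {A : Set} → (A → Bool) → A × A → Bool
inversion h (x , y) = not (h x) ∧ h y

inversion-≤ : ∀ a b → bit b ≤ bit a + bit (not a ∧ b)
inversion-≤ true true = ≤-refl
inversion-≤ true false = z≤n
inversion-≤ false b = ≤-refl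

-- All edges of the augmented line of length 2^k, arranged as the sorting recursion meets them. A
-- step of length at least 2 keeps the parity and is the double of an edge of the half-length line;
-- the last two lists are the unit steps. The last odd position has no successor, whence `pred`.
lineEdges : ℕ → List (ℕ × ℕ)
lineEdges zero = []
lineEdges (suc k) =
  (map (λ (x , y) → dbl x , dbl y) (lineEdges k) ++ map (λ (x , y) → odd x , odd y) (lineEdges k)) ++
  (map (λ j → dbl j , odd j) (downFrom (2 ^ k)) ++ map (λ j → odd j , dbl (suc j)) (downFrom (pred (2 ^ k))))

module _ (h : ℕ → Bool) where

  -- Call a position where `h` holds a token. A token without a token just below it is an inversion
  -- on a unit edge. This compares each odd position with the even one below it and each even
  -- position with the odd one below it; position 0 has nothing below, which accounts for the `suc`.
  even-odd-counts : ∀ m → let t = count (inversion h) (map (λ j → dbl j , odd j) (downFrom (suc m)) ++ map (λ j → odd j , dbl (suc j)) (downFrom m))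
                              a = count (h ∘ dbl) (downFrom (suc m)) ; b = count (h ∘ odd) (downFrom (suc m))
    in b ≤ a + t × a ≤ suc (b + t)
  even-odd-counts m = b≤ , a≤
    where
    open ≤-Reasoning
    e₁ e₂ : ℕ → ℕ × ℕ
    e₁ j = dbl j , odd j
    e₂ j = odd j , dbl (suc j)
    a = count (h ∘ dbl) (downFrom (suc m))
    b = count (h ∘ odd) (downFrom (suc m))
    t = count (inversion h) (map e₁ (downFrom (suc m)) ++ map e₂ (downFrom m))
    t₁ = count (inversion h ∘ e₁) (downFrom (suc m))
    t₂ = count (inversion h ∘ e₂) (downFrom m)
    t≡ : t ≡ t₁ + t₂
    t≡ = trans (∑-++ _ (map e₁ (downFrom (suc m))) _) (cong₂ _+_ (∑-map _ e₁ (downFrom (suc m))) (∑-map _ e₂ (downFrom m)))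
    b≤ : b ≤ a + t
    b≤ = begin
      b                                                                        ≤⟨ ∑-mono (downFrom (suc m)) (λ j → inversion-≤ (h (dbl j)) (h (odd j))) ⟩
      ∑ (λ j → bit (h (dbl j)) + bit (inversion h (e₁ j))) (downFrom (suc m))  ≡⟨ ∑-+ (bit ∘ h ∘ dbl) (bit ∘ inversion h ∘ e₁) (downFrom (suc m)) ⟩
      a + t₁                                                                   ≤⟨ +-monoʳ-≤ a (≤-trans (m≤m+n t₁ t₂) (≤-reflexive (sym t≡))) ⟩
      a + t                                                                    ∎
    bit≤1 : ∀ c → bit c ≤ 1
    bit≤1 true = ≤-refl
    bit≤1 false = z≤n
    a≤ : a ≤ suc (b + t)
    a≤ = begin
      a                                                                        ≡⟨ ∑-↭ _ (downFrom-suc m) ⟩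
      bit (h 0) + count (h ∘ dbl) (map suc (downFrom m))                       ≡⟨ cong (bit (h 0) +_) (∑-map _ suc (downFrom m)) ⟩
      bit (h 0) + count (h ∘ dbl ∘ suc) (downFrom m)                           ≤⟨ +-mono-≤ (bit≤1 (h 0)) (∑-mono (downFrom m) (λ j → inversion-≤ (h (odd j)) (h (dbl (suc j))))) ⟩
      suc (∑ (λ j → bit (h (odd j)) + bit (inversion h (e₂ j))) (downFrom m))  ≡⟨ cong suc (∑-+ (bit ∘ h ∘ odd) (bit ∘ inversion h ∘ e₂) (downFrom m)) ⟩
      suc (count (h ∘ odd) (downFrom m) + t₂)                                  ≤⟨ s≤s (+-mono-≤ (m≤n+m _ (bit (h (odd m)))) (≤-trans (m≤n+m t₂ t₁) (≤-reflexive (sym t≡)))) ⟩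
      suc (b + t)                                                              ∎

-- The transport runs from the sorted positions to the actual ones, so the merge comes first and the
-- two halves second. The merge is governed by `a` and `b` alone, and these are the numbers of
-- tokens in the unsorted halves, so it can be charged to the unit inversions of `h` itself.
line-sort : ∀ k h → Moves≤ (2 * count (inversion h) (lineEdges k)) (downFrom (count h (downFrom (2 ^ k)))) (filterᵇ h (downFrom (2 ^ k)))
line-sort zero h with h 0
... | true = 0 , transport-refl [] (0 ∷ []) , z≤n
... | false = 0 , transport-refl [] [] , z≤n
line-sort (suc k) h with line-sort k (h ∘ dbl) | line-sort k (h ∘ odd)
... | c₁ , m₁ , c₁≤ | c₂ , m₂ , c₂≤ with interleave a b t (proj₁ bounds) (proj₂ bounds)
  where
  a = count (h ∘ dbl) (downFrom (2 ^ k))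
  b = count (h ∘ odd) (downFrom (2 ^ k))
  t = count (inversion h) (map (λ j → dbl j , odd j) (downFrom (2 ^ k)) ++ map (λ j → odd j , dbl (suc j)) (downFrom (pred (2 ^ k))))
  bounds : b ≤ a + t × a ≤ suc (b + t)
  bounds with 2 ^ k | m^n>0 2 k
  ... | suc m | _ = even-odd-counts h m
...   | c₀ , m₀ , c₀≤ =
    c₀ + (c₁ + c₂) ,
    transport-↭ˡ (↭-reflexive (cong downFrom total))
      (transport-↭ʳ (transport-trans climb-trans m₀
        (transport-++ (transport-map dbl climb-dbl m₁) (transport-map odd (climb-suc ∘ climb-dbl) m₂))) target) ,
    cost
  where
  N = downFrom (2 ^ k)
  E = lineEdges k
  F = map (λ j → dbl j , odd j) (downFrom (2 ^ k)) ++ map (λ j → odd j , dbl (suc j)) (downFrom (pred (2 ^ k)))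
  halves : downFrom (2 ^ suc k) ↭ map dbl N ++ map odd N
  halves = ↭-trans (↭-reflexive (cong downFrom (sym (dbl-2^ k)))) (downFrom-dbl (2 ^ k))
  total : count h (downFrom (2 ^ suc k)) ≡ count (h ∘ dbl) N + count (h ∘ odd) N
  total = trans (∑-↭ _ halves) (trans (∑-++ _ (map dbl N) (map odd N)) (cong₂ _+_ (∑-map _ dbl N) (∑-map _ odd N)))
  target : map dbl (filterᵇ (h ∘ dbl) N) ++ map odd (filterᵇ (h ∘ odd) N) ↭ filterᵇ h (downFrom (2 ^ suc k))
  target = begin
    map dbl (filterᵇ (h ∘ dbl) N) ++ map odd (filterᵇ (h ∘ odd) N)   ≡⟨ cong₂ _++_ (sym (filterᵇ-map h dbl N)) (sym (filterᵇ-map h odd N)) ⟩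
    filterᵇ h (map dbl N) ++ filterᵇ h (map odd N)                   ≡⟨ sym (filterᵇ-++ h (map dbl N) (map odd N)) ⟩
    filterᵇ h (map dbl N ++ map odd N)                               ↭⟨ filterᵇ-↭ h (↭-sym halves) ⟩
    filterᵇ h (downFrom (2 ^ suc k))                                 ∎
    where open PermutationReasoning
  cost : c₀ + (c₁ + c₂) ≤ 2 * count (inversion h) (lineEdges (suc k))
  cost = begin
    c₀ + (c₁ + c₂)                               ≤⟨ +-mono-≤ c₀≤ (+-mono-≤ c₁≤ c₂≤) ⟩
    2 * t + (2 * s₁ + 2 * s₂)                    ≡⟨ cong (2 * t +_) (sym (*-distribˡ-+ 2 s₁ s₂)) ⟩
    2 * t + 2 * (s₁ + s₂)                        ≡⟨ +-comm (2 * t) _ ⟩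
    2 * (s₁ + s₂) + 2 * t                        ≡⟨ sym (*-distribˡ-+ 2 (s₁ + s₂) t) ⟩
    2 * ((s₁ + s₂) + t)                          ≡⟨ cong (λ z → 2 * (z + t)) (sym (cong₂ _+_ (∑-map _ _ E) (∑-map _ _ E))) ⟩
    2 * ((count (inversion h) E₁ + count (inversion h) E₂) + t)  ≡⟨ cong (λ z → 2 * (z + t)) (sym (∑-++ _ E₁ E₂)) ⟩
    2 * (count (inversion h) (E₁ ++ E₂) + t)     ≡⟨ cong (2 *_) (sym (∑-++ _ (E₁ ++ E₂) F)) ⟩
    2 * count (inversion h) (lineEdges (suc k))  ∎
    where
    open ≤-Reasoning
    s₁ = count (inversion (h ∘ dbl)) E
    s₂ = count (inversion (h ∘ odd)) E
    t = count (inversion h) F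
    E₁ = map (λ (x , y) → dbl x , dbl y) E
    E₂ = map (λ (x , y) → odd x , odd y) E

-- Sorting the grid

filterᵇ-cong : ∀ {A : Set} {g h : A → Bool} → (∀ x → g x ≡ h x) → ∀ xs → filterᵇ g xs ≡ filterᵇ h xs
filterᵇ-cong g≡h [] = refl
filterᵇ-cong {g = g} {h} g≡h (x ∷ xs) with g x | h x | g≡h x
... | true | true | _ = cong (x ∷_) (filterᵇ-cong g≡h xs)
... | false | false | _ = filterᵇ-cong g≡h xs

length-filterᵇ : ∀ {A : Set} (h : A → Bool) xs → length (filterᵇ h xs) ≡ count h xs
length-filterᵇ h [] = refl
length-filterᵇ h (x ∷ xs) with h x
... | true = cong suc (length-filterᵇ h xs)
... | false = length-filterᵇ h xs

count≤length : ∀ {A : Set} (h : A → Bool) xs → count h xs ≤ length xs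
count≤length h [] = z≤n
count≤length h (x ∷ xs) with h x
... | true = s≤s (count≤length h xs)
... | false = m≤n⇒m≤1+n (count≤length h xs)

filterᵇ-concatMap : ∀ {A B : Set} (h : B → Bool) (g : A → List B) xs → filterᵇ h (concatMap g xs) ≡ concatMap (filterᵇ h ∘ g) xs
filterᵇ-concatMap h g [] = refl
filterᵇ-concatMap h g (x ∷ xs) = trans (filterᵇ-++ h (g x) _) (cong (filterᵇ h (g x) ++_) (filterᵇ-concatMap h g xs))

-- With consing as `f`, this regroups the points of the grid from slices with fixed first coordinate
-- into lines along that coordinate.
concatMap-map-swap : ∀ {A B C : Set} (f : A → B → C) xs ys →
  concatMap (λ a → map (f a) ys) xs ↭ concatMap (λ b → map (λ a → f a b) xs) ys
concatMap-map-swap f [] ys = ↭-reflexive (sym (empty ys))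
  where
  empty : ∀ ys → concatMap (λ b → []) ys ≡ []
  empty [] = refl
  empty (y ∷ ys) = empty ys
concatMap-map-swap f (x ∷ xs) ys =
  ↭-trans (Perm.++⁺ˡ (map (f x) ys) (concatMap-map-swap f xs ys)) (heads (f x) (λ b → map (λ a → f a b) xs) ys)
  where
  heads : ∀ {B C : Set} (g : B → C) (k : B → List C) ys → map g ys ++ concatMap k ys ↭ concatMap (λ y → g y ∷ k y) ys
  heads g k [] = refl
  heads g k (y ∷ ys) = prep (g y) (↭-trans (Perm.shifts (map g ys) (k y)) (Perm.++⁺ˡ (k y) (heads g k ys)))

transport-concatMap : ∀ {A V : Set} {R : ℕ → V → V → Set} {c : A → ℕ} {f g : A → List V} →
  (∀ a → Transport R (c a) (f a) (g a)) → ∀ as → Transport R (∑ c as) (concatMap f as) (concatMap g as)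
transport-concatMap t [] = [] , [] , refl
transport-concatMap t (a ∷ as) = transport-++ (t a) (transport-concatMap t as)

transport-unmap : ∀ {V W : Set} {R : ℕ → W → W → Set} (φ : V → W) {c xs ys} →
  Transport R c (map φ xs) (map φ ys) → Transport (λ ℓ → R ℓ on φ) c xs ys
transport-unmap {R = R} φ {xs = xs} (zs , p , e) with Perm.↭-map-inv φ (↭-sym e)
... | zs′ , refl , e′ = zs′ , go xs zs′ p , ↭-sym e′
  where
  go : ∀ {c} xs ys → Paired R c (map φ xs) (map φ ys) → Paired (λ ℓ → R ℓ on φ) c xs ys
  go [] [] [] = []
  go (x ∷ xs) (y ∷ ys) (r ∷ p) = r ∷ go xs ys p

transport-length : ∀ {V : Set} {R : ℕ → V → V → Set} {c xs ys} → Transport R c xs ys → length xs ≡ length ys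
transport-length {R = R} (zs , p , e) = trans (go p) (Perm.↭-length e)
  where
  go : ∀ {c xs ys} → Paired R c xs ys → length xs ≡ length ys
  go [] = refl
  go (_ ∷ p) = cong suc (go p)

map-toℕ-allFin : ∀ n → map toℕ (allFin n) ↭ downFrom n
map-toℕ-allFin zero = refl
map-toℕ-allFin (suc n) = begin
  0 ∷ map toℕ (tabulate Fin.suc)         ≡⟨ cong (λ l → 0 ∷ map toℕ l) (map-tabulate id Fin.suc) ⟨
  0 ∷ map toℕ (map Fin.suc (allFin n))   ≡⟨ cong (0 ∷_) (trans (sym (map-∘ (allFin n))) (map-∘ (allFin n))) ⟩
  0 ∷ map suc (map toℕ (allFin n))       ↭⟨ prep 0 (Perm.map⁺ suc (map-toℕ-allFin n)) ⟩
  0 ∷ map suc (downFrom n)               ↭⟨ downFrom-suc n ⟨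
  downFrom (suc n)                       ∎
  where open PermutationReasoning

filterᵇ-<-downFrom : ∀ {m n} → m ≤ n → filterᵇ (_<ᵇ m) (downFrom n) ≡ downFrom m
filterᵇ-<-downFrom {m} {n} m≤n = subst (λ n → filterᵇ (_<ᵇ m) (downFrom n) ≡ downFrom m) (m∸n+n≡m m≤n) (go (n ∸ m))
  where
  keep : ∀ l → l ≤ m → filterᵇ (_<ᵇ m) (downFrom l) ≡ downFrom l
  keep zero _ = refl
  keep (suc l) l< with l <ᵇ m | <⇒<ᵇ l<
  ... | true | _ = cong (l ∷_) (keep l (<⇒≤ l<))
  go : ∀ o → filterᵇ (_<ᵇ m) (downFrom (o + m)) ≡ downFrom m
  go zero = keep m ≤-refl
  go (suc o) with o + m <ᵇ m in eq
  ... | false = go o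
  ... | true = contradiction (<ᵇ⇒< (o + m) m (subst T (sym eq) _)) (≤⇒≯ (m≤n+m m o))

LineEdge : ℕ → ℕ × ℕ → Set
LineEdge n (x , y) = (∃ λ a → y ≡ x + 2 ^ a) × y < n

dbl-mono-≤ : ∀ {m n} → m ≤ n → dbl m ≤ dbl n
dbl-mono-≤ z≤n = z≤n
dbl-mono-≤ (s≤s le) = s≤s (s≤s (dbl-mono-≤ le))

dbl-injective : ∀ {m n} → dbl m ≡ dbl n → m ≡ n
dbl-injective {zero} {zero} _ = refl
dbl-injective {suc m} {suc n} e = cong suc (dbl-injective (suc-injective (suc-injective e)))

downFrom-< : ∀ n → All (_< n) (downFrom n)
downFrom-< zero = []
downFrom-< (suc n) = ≤-refl ∷ All.map m≤n⇒m≤1+n (downFrom-< n)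

lineEdges-valid : ∀ k → All (LineEdge (2 ^ k)) (lineEdges k)
lineEdges-valid zero = []
lineEdges-valid (suc k) =
  Allₚ.++⁺ (Allₚ.++⁺ (Allₚ.map⁺ (All.map even (lineEdges-valid k))) (Allₚ.map⁺ (All.map odds (lineEdges-valid k))))
    (Allₚ.++⁺ (Allₚ.map⁺ (All.map (λ {j} j< → (0 , +-comm 1 (dbl j)) , odd< j<) (downFrom-< (2 ^ k))))
      (Allₚ.map⁺ (All.map (λ {j} j< → (0 , +-comm 1 (odd j)) , <-trans (n<1+n _) (odd< (below j<))) (downFrom-< (pred (2 ^ k))))))
  where
  odd< : ∀ {y} → y < 2 ^ k → odd y < 2 ^ suc k
  odd< y< = ≤-trans (dbl-mono-≤ y<) (≤-reflexive (dbl-2^ k))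
  below : ∀ {j} → j < pred (2 ^ k) → suc j < 2 ^ k
  below j< with 2 ^ k | m^n>0 2 k
  ... | suc m | _ = s≤s j<
  doubled : ∀ x a → dbl (x + 2 ^ a) ≡ dbl x + 2 ^ suc a
  doubled x a = trans (dbl-+ x (2 ^ a)) (cong (dbl x +_) (dbl-2^ a))
  even : ∀ {e} → LineEdge (2 ^ k) e → LineEdge (2 ^ suc k) (dbl (proj₁ e) , dbl (proj₂ e))
  even {x , y} ((a , refl) , y<) = (suc a , doubled x a) , <-trans (n<1+n _) (odd< y<)
  odds : ∀ {e} → LineEdge (2 ^ k) e → LineEdge (2 ^ suc k) (odd (proj₁ e) , odd (proj₂ e))
  odds {x , y} ((a , refl) , y<) = (suc a , cong suc (doubled x a)) , odd< y<

isOdd : ℕ → Bool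
isOdd zero = false
isOdd (suc n) = not (isOdd n)

isOdd-dbl : ∀ n → isOdd (dbl n) ≡ false
isOdd-dbl zero = refl
isOdd-dbl (suc n) = cong (not ∘ not) (isOdd-dbl n)

unique-++-labelled : ∀ {A B : Set} (φ : A → B) {b c} {xs ys : List A} → b ≢ c →
  All (λ x → φ x ≡ b) xs → All (λ y → φ y ≡ c) ys → Unique xs → Unique ys → Unique (xs ++ ys)
unique-++-labelled φ b≢c all-b all-c uxs uys =
  Uniqueₚ.++⁺ uxs uys (λ (x∈ , y∈) → b≢c (trans (sym (All.lookup all-b x∈)) (All.lookup all-c y∈)))

-- Two parities tell the four lists apart: whether the endpoints differ in parity, and the parity of
-- the lower endpoint. The absence of repetitions lets inversions be charged to distinct elements of
-- S⁻.
lineEdges-unique : ∀ k → Unique (lineEdges k)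
lineEdges-unique zero = []
lineEdges-unique (suc k) = unique-++-labelled mixed (λ ()) (Allₚ.++⁺ ee-mixed oo-mixed) (Allₚ.++⁺ eo-mixed oe-mixed)
    (unique-++-labelled (isOdd ∘ proj₁) (λ ()) ee-par oo-par
      (Uniqueₚ.map⁺ (λ e → cong₂ _,_ (dbl-injective (cong proj₁ e)) (dbl-injective (cong proj₂ e))) (lineEdges-unique k))
      (Uniqueₚ.map⁺ (λ e → cong₂ _,_ (dbl-injective (suc-injective (cong proj₁ e))) (dbl-injective (suc-injective (cong proj₂ e)))) (lineEdges-unique k)))
    (unique-++-labelled (isOdd ∘ proj₁) (λ ()) eo-par oe-par
      (Uniqueₚ.map⁺ (λ e → dbl-injective (cong proj₁ e)) (Uniqueₚ.downFrom⁺ _))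
      (Uniqueₚ.map⁺ (λ e → dbl-injective (suc-injective (cong proj₁ e))) (Uniqueₚ.downFrom⁺ _)))
  where
  mixed : ℕ × ℕ → Bool
  mixed (x , y) = isOdd x xor isOdd y
  E = lineEdges k
  even-par : ∀ {A : Set} (φ : A → ℕ) (ψ : A → ℕ) xs → All (λ (e : ℕ × ℕ) → isOdd (proj₁ e) ≡ false) (map (λ a → dbl (φ a) , ψ a) xs)
  even-par φ ψ xs = Allₚ.map⁺ (All.universal (λ a → isOdd-dbl (φ a)) xs)
  odd-par : ∀ {A : Set} (φ : A → ℕ) (ψ : A → ℕ) xs → All (λ (e : ℕ × ℕ) → isOdd (proj₁ e) ≡ true) (map (λ a → odd (φ a) , ψ a) xs)
  odd-par φ ψ xs = Allₚ.map⁺ (All.universal (λ a → cong not (isOdd-dbl (φ a))) xs)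
  ee-par = even-par proj₁ (dbl ∘ proj₂) E
  oo-par = odd-par proj₁ (odd ∘ proj₂) E
  eo-par = even-par id odd (downFrom (2 ^ k))
  oe-par = odd-par id (dbl ∘ suc) (downFrom (pred (2 ^ k)))
  ee-mixed : All (λ e → mixed e ≡ false) (map (λ (x , y) → dbl x , dbl y) E)
  ee-mixed = Allₚ.map⁺ (All.universal (λ (x , y) → cong₂ _xor_ (isOdd-dbl x) (isOdd-dbl y)) E)
  oo-mixed : All (λ e → mixed e ≡ false) (map (λ (x , y) → odd x , odd y) E)
  oo-mixed = Allₚ.map⁺ (All.universal (λ (x , y) → cong₂ _xor_ (cong not (isOdd-dbl x)) (cong not (isOdd-dbl y))) E)
  eo-mixed : All (λ e → mixed e ≡ true) (map (λ j → dbl j , odd j) (downFrom (2 ^ k)))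
  eo-mixed = Allₚ.map⁺ (All.universal (λ j → cong₂ _xor_ (isOdd-dbl j) (cong not (isOdd-dbl j))) (downFrom (2 ^ k)))
  oe-mixed : All (λ e → mixed e ≡ true) (map (λ j → odd j , dbl (suc j)) (downFrom (pred (2 ^ k))))
  oe-mixed = Allₚ.map⁺ (All.universal (λ j → cong₂ _xor_ (cong not (isOdd-dbl j)) (isOdd-dbl (suc j))) (downFrom (pred (2 ^ k))))

bit-mono : ∀ {a b} → (a ≡ true → b ≡ true) → bit a ≤ bit b
bit-mono {false} imp = z≤n
bit-mono {true} {b} imp rewrite imp refl = ≤-refl

climb-≤ : ∀ {ℓ x y} → Climb ℓ x y → x ≤ y
climb-≤ [] = ≤-refl
climb-≤ {x = x} (step a refl p) = ≤-trans (m≤m+n x (2 ^ a)) (climb-≤ p)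

data Walk {n d} : ℕ → Point n d → Point n d → Set where
  []  : ∀ {x} → Walk 0 x x
  _∷_ : ∀ {ℓ x y z} → IsEdge x y → Walk ℓ y z → Walk (suc ℓ) x z

walk-trans : ∀ {n d k l} {x y z : Point n d} → Walk k x y → Walk l y z → Walk (k + l) x z
walk-trans [] q = q
walk-trans (e ∷ p) q = e ∷ walk-trans p q

edge-head : ∀ {n d} {a b : Fin n} (x : Point n d) c → toℕ b ≡ toℕ a + 2 ^ c → IsEdge (a ∷ x) (b ∷ x)
edge-head x c e = Fin.zero , (λ { Fin.zero ne → contradiction refl ne ; (Fin.suc j) _ → refl }) , c , e

edge-tail : ∀ {n d} (a : Fin n) {x y : Point n d} → IsEdge x y → IsEdge (a ∷ x) (a ∷ y)
edge-tail a (i , same , c , e) =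
  Fin.suc i , (λ { Fin.zero _ → refl ; (Fin.suc j) ne → same j (ne ∘ cong Fin.suc) }) , c , e

walk-head : ∀ {n d ℓ} (x : Point n d) {a b : Fin n} → Climb ℓ (toℕ a) (toℕ b) → Walk ℓ (a ∷ x) (b ∷ x)
walk-head {n} x {a} {b} p = go p refl refl
  where
  go : ∀ {ℓ u v} {a b : Fin n} → Climb ℓ u v → toℕ a ≡ u → toℕ b ≡ v → Walk ℓ (a ∷ x) (b ∷ x)
  go {a = a} {b} [] ea eb with toℕ-injective (trans ea (sym eb))
  ... | refl = []
  go {a = a} {b} (step {y = y} c e p) refl refl =
    edge-head x c (trans (toℕ-fromℕ< y<n) e) ∷ go p (toℕ-fromℕ< y<n) refl
    where
    -- Climbs only go up, so the end of the climb, which lies in the grid, bounds every intermediate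
    -- value.
    y<n : y < n
    y<n = ≤-<-trans (climb-≤ p) (toℕ<n b)

walk-tail : ∀ {n d ℓ} (a : Fin n) {x y : Point n d} → Walk ℓ x y → Walk ℓ (a ∷ x) (a ∷ y)
walk-tail a [] = []
walk-tail a (e ∷ p) = edge-tail a e ∷ walk-tail a p

sortLine : ∀ {n} → (Fin n → Bool) → Fin n → Bool
sortLine {n} h i = toℕ i <ᵇ count h (allFin n)

-- The later coordinates come first: the line sorted along the first coordinate is taken from slices
-- that are already sorted.
sortGrid : ∀ {n} d → BoolFn n d → BoolFn n d
sortGrid zero h = h
sortGrid (suc d) h (a ∷ x) = sortLine (λ b → sortGrid d (λ y → h (b ∷ y)) x) a

<ᵇ-mono : ∀ {a b m m′} → a ≤ b → m ≤ m′ → (b <ᵇ m) ≡ true → (a <ᵇ m′) ≡ true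
<ᵇ-mono {a} {b} {m} a≤b m≤m′ e =
  Equivalence.to T-≡ (<⇒<ᵇ (<-≤-trans (≤-<-trans a≤b (<ᵇ⇒< b m (Equivalence.from T-≡ e))) m≤m′))

sortGrid-mono : ∀ {n} d {g h : BoolFn n d} → (∀ x → g x ≡ true → h x ≡ true) → ∀ x → sortGrid d g x ≡ true → sortGrid d h x ≡ true
sortGrid-mono zero imp x = imp x
sortGrid-mono {n} (suc d) imp (a ∷ x) =
  <ᵇ-mono {toℕ a} ≤-refl (∑-mono (allFin n) λ b → bit-mono (sortGrid-mono d (λ y → imp (b ∷ y)) x))

-- Sorting along the first coordinate does not spoil the order in the others: the sorted slices are
-- antitone, so the line over `y` carries no more tokens than the line over `x`, and its initial
-- segment of tokens is no longer.
sortGrid-antitone : ∀ {n} d (h : BoolFn n d) x y → x ⪯ y → sortGrid d h y ≡ true → sortGrid d h x ≡ true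
sortGrid-antitone zero h [] [] _ e = e
sortGrid-antitone {n} (suc d) h (a ∷ x) (b ∷ y) le =
  <ᵇ-mono {toℕ a} (le Fin.zero) (∑-mono (allFin n) λ c → bit-mono (sortGrid-antitone d (λ z → h (c ∷ z)) x y (le ∘ Fin.suc)))

module Sorting (k : ℕ) where

  n : ℕ
  n = 2 ^ k

  toFin : (es : List (ℕ × ℕ)) → All (LineEdge n) es → List (Fin n × Fin n)
  toFin [] [] = []
  toFin ((x , y) ∷ es) (((a , e) , y<) ∷ ps) =
    (fromℕ< (≤-<-trans (≤-trans (m≤m+n x (2 ^ a)) (≤-reflexive (sym e))) y<) , fromℕ< y<) ∷ toFin es ps

  toℕ² : Fin n × Fin n → ℕ × ℕ
  toℕ² (x , y) = toℕ x , toℕ y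

  map-toFin : ∀ es ps → map toℕ² (toFin es ps) ≡ es
  map-toFin [] [] = refl
  map-toFin (_ ∷ es) (((a , e) , y<) ∷ ps) = cong₂ _∷_ (cong₂ _,_ (toℕ-fromℕ< _) (toℕ-fromℕ< y<)) (map-toFin es ps)

  finEdges : List (Fin n × Fin n)
  finEdges = toFin (lineEdges k) (lineEdges-valid k)

  map-finEdges : map toℕ² finEdges ≡ lineEdges k
  map-finEdges = map-toFin (lineEdges k) (lineEdges-valid k)

  -- Line sorting is stated for functions on ℕ; only the values below `n` enter it, and `false` is a
  -- filler.
  extend : (Fin n → Bool) → ℕ → Bool
  extend h j with j <? n
  ... | yes j< = h (fromℕ< j<)
  ... | no _ = false

  extend-toℕ : ∀ h i → extend h (toℕ i) ≡ h i
  extend-toℕ h i with toℕ i <? n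
  ... | yes i< = cong h (fromℕ<-toℕ i i<)
  ... | no i≮ = contradiction (toℕ<n i) i≮

  FinClimb : ℕ → Fin n → Fin n → Set
  FinClimb ℓ = Climb ℓ on toℕ

  sortLine-transport : ∀ h → ∃ λ c → Transport FinClimb c (filterᵇ (sortLine h) (allFin n)) (filterᵇ h (allFin n)) ×
    c ≤ 2 * count (inversion h) finEdges
  sortLine-transport h with line-sort k (extend h)
  ... | c , t , c≤ = c , transport-unmap toℕ (transport-↭ˡ source (transport-↭ʳ t target)) ,
                     ≤-trans c≤ (≤-reflexive (cong (2 *_) edges))
    where
    N = allFin n
    m = count h N
    count-extend : count (extend h) (downFrom n) ≡ m
    count-extend = trans (∑-↭ _ (↭-sym (map-toℕ-allFin n))) (trans (∑-map _ toℕ N) (∑-cong N (cong bit ∘ extend-toℕ h)))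
    m≤n : m ≤ n
    m≤n = ≤-trans (count≤length h N) (≤-reflexive (length-tabulate id))
    open PermutationReasoning
    source : map toℕ (filterᵇ (sortLine h) N) ↭ downFrom (count (extend h) (downFrom n))
    source = begin
      map toℕ (filterᵇ (sortLine h) N)              ≡⟨ filterᵇ-map (_<ᵇ m) toℕ N ⟨
      filterᵇ (_<ᵇ m) (map toℕ N)                   ↭⟨ filterᵇ-↭ (_<ᵇ m) (map-toℕ-allFin n) ⟩
      filterᵇ (_<ᵇ m) (downFrom n)                  ≡⟨ filterᵇ-<-downFrom m≤n ⟩
      downFrom m                                    ≡⟨ cong downFrom count-extend ⟨
      downFrom (count (extend h) (downFrom n))      ∎
    target : filterᵇ (extend h) (downFrom n) ↭ map toℕ (filterᵇ h N)
    target = begin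
      filterᵇ (extend h) (downFrom n)               ↭⟨ filterᵇ-↭ (extend h) (↭-sym (map-toℕ-allFin n)) ⟩
      filterᵇ (extend h) (map toℕ N)                ≡⟨ filterᵇ-map (extend h) toℕ N ⟩
      map toℕ (filterᵇ (extend h ∘ toℕ) N)          ≡⟨ cong (map toℕ) (filterᵇ-cong (extend-toℕ h) N) ⟩
      map toℕ (filterᵇ h N)                         ∎
    edges : count (inversion (extend h)) (lineEdges k) ≡ count (inversion h) finEdges
    edges = trans (cong (count (inversion (extend h))) (sym map-finEdges)) (trans (∑-map _ toℕ² finEdges)
      (∑-cong finEdges λ (x , y) → cong₂ (λ a b → bit (not a ∧ b)) (extend-toℕ h x) (extend-toℕ h y)))

  gridEdges : ∀ d → List (Pair n d)
  gridEdges zero = []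
  gridEdges (suc d) =
    concatMap (λ a → map (λ (x , y) → a ∷ x , a ∷ y) (gridEdges d)) (allFin n) ++
    concatMap (λ (a , b) → map (λ x → a ∷ x , b ∷ x) (allPoints n d)) finEdges

  -- Sorting preserves sizes and inclusions, so sortGrid (g ∧ h) lies below both sorted functions.
  contraction : ∀ d → (∀ h → count (sortGrid d h) (allPoints n d) ≡ count h (allPoints n d)) → ∀ g h →
    count (λ x → not (sortGrid d g x) ∧ sortGrid d h x) (allPoints n d) ≤ count (λ x → not (g x) ∧ h x) (allPoints n d)
  contraction d preserve g h = +-cancelʳ-≤ (count gh P) _ _ (begin
    count (λ x → not (sortGrid d g x) ∧ sortGrid d h x) P + count gh P                 ≡⟨ cong (count (λ x → not (sortGrid d g x) ∧ sortGrid d h x) P +_) (sym (preserve gh)) ⟩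
    count (λ x → not (sortGrid d g x) ∧ sortGrid d h x) P + count (sortGrid d gh) P    ≡⟨ ∑-+ _ _ P ⟨
    ∑ (λ x → bit (not (sortGrid d g x) ∧ sortGrid d h x) + bit (sortGrid d gh x)) P    ≤⟨ ∑-mono P (λ x → below (sortGrid d g x) (sortGrid d h x) _ (sortGrid-mono d (λ y → ∧-left (g y)) x) (sortGrid-mono d (λ y → ∧-right (g y)) x)) ⟩
    count (sortGrid d h) P                                                             ≡⟨ preserve h ⟩
    count h P                                                                          ≡⟨ ∑-cong P (λ x → split (g x) (h x)) ⟩
    ∑ (λ x → bit (not (g x) ∧ h x) + bit (gh x)) P                                     ≡⟨ ∑-+ _ _ P ⟩
    count (λ x → not (g x) ∧ h x) P + count gh P                                       ∎)
    where
    open ≤-Reasoning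
    P = allPoints n d
    gh : BoolFn n d
    gh x = g x ∧ h x
    ∧-left : ∀ a {b} → a ∧ b ≡ true → a ≡ true
    ∧-left true _ = refl
    ∧-right : ∀ a {b} → a ∧ b ≡ true → b ≡ true
    ∧-right true e = e
    split : ∀ a b → bit b ≡ bit (not a ∧ b) + bit (a ∧ b)
    split true b = refl
    split false b = sym (+-identityʳ _)
    below : ∀ a b c → (c ≡ true → a ≡ true) → (c ≡ true → b ≡ true) → bit (not a ∧ b) + bit c ≤ bit b
    below a b true p q rewrite p refl | q refl = ≤-refl
    below true b false p q = z≤n
    below false b false p q = ≤-reflexive (+-identityʳ _)

  support : ∀ d → BoolFn n d → List (Point n d)
  support d h = filterᵇ h (allPoints n d)

  -- In dimension `suc d`, `g` is `h` with sorted slices. Sorting the lines of `g` is charged to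
  -- inversions of `g`, which `contraction` bounds by inversions of `h`. For this, sorting in
  -- dimension `d` must preserve the number of tokens, which is read off from the transport in
  -- dimension `d`; hence the mutual recursion.
  sortGrid-transport : ∀ d h → ∃ λ c → Transport Walk c (support d (sortGrid d h)) (support d h) ×
    c ≤ 2 * count (inversion h) (gridEdges d)

  sortGrid-count : ∀ d h → count (sortGrid d h) (allPoints n d) ≡ count h (allPoints n d)
  sortGrid-count d h = begin
    count (sortGrid d h) (allPoints n d)   ≡⟨ length-filterᵇ (sortGrid d h) (allPoints n d) ⟨
    length (support d (sortGrid d h))      ≡⟨ transport-length (proj₁ (proj₂ (sortGrid-transport d h))) ⟩
    length (support d h)                   ≡⟨ length-filterᵇ h (allPoints n d) ⟩
    count h (allPoints n d)                ∎
    where open ≡-Reasoning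

  sortGrid-transport zero h = 0 , transport-refl [] _ , z≤n
  sortGrid-transport (suc d) h =
    ∑ cˡ P + ∑ cˢ N ,
    transport-trans walk-trans
      (transport-↭ˡ (↭-trans (filterᵇ-↭ (sortGrid (suc d) h) by-lines) (↭-reflexive (lines (sortGrid (suc d) h))))
        (transport-↭ʳ (transport-concatMap (λ x → transport-map (_∷ x) (walk-head x) (proj₁ (proj₂ (lineT x)))) P)
          (↭-sym (↭-trans (filterᵇ-↭ g by-lines) (↭-reflexive (lines g))))))
      (transport-↭ˡ (↭-reflexive (slices g))
        (transport-↭ʳ (transport-concatMap (λ a → transport-map (a ∷_) (walk-tail a) (proj₁ (proj₂ (sliceT a)))) N)
          (↭-reflexive (sym (slices h))))) ,
    cost
    where
    N = allFin n
    P = allPoints n d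
    g : BoolFn n (suc d)
    g (b ∷ x) = sortGrid d (λ y → h (b ∷ y)) x
    lineT : ∀ x → _
    lineT x = sortLine-transport (λ b → g (b ∷ x))
    sliceT : ∀ a → _
    sliceT a = sortGrid-transport d (λ y → h (a ∷ y))
    cˡ : Point n d → ℕ
    cˡ x = proj₁ (lineT x)
    cˢ : Fin n → ℕ
    cˢ a = proj₁ (sliceT a)
    by-lines : allPoints n (suc d) ↭ concatMap (λ x → map (_∷ x) N) P
    by-lines = concatMap-map-swap (λ a x → a ∷ x) N P
    lines : ∀ h → filterᵇ h (concatMap (λ x → map (_∷ x) N) P) ≡ concatMap (λ x → map (_∷ x) (filterᵇ (λ a → h (a ∷ x)) N)) P
    lines h = trans (filterᵇ-concatMap h _ P) (concatMap-cong (λ x → filterᵇ-map h (_∷ x) N) P)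
    slices : ∀ h → support (suc d) h ≡ concatMap (λ a → map (a ∷_) (filterᵇ (λ x → h (a ∷ x)) P)) N
    slices h = trans (filterᵇ-concatMap h _ N) (concatMap-cong (λ a → filterᵇ-map h (a ∷_) P) N)
    E₁ = concatMap (λ a → map (λ (x , y) → a ∷ x , a ∷ y) (gridEdges d)) N
    E₂ = concatMap (λ (a , b) → map (λ x → a ∷ x , b ∷ x) P) finEdges
    open ≤-Reasoning
    cost-lines : ∑ cˡ P ≤ 2 * count (inversion h) E₂
    cost-lines = begin
      ∑ cˡ P                                                                                   ≤⟨ ∑-mono P (λ x → proj₂ (proj₂ (lineT x))) ⟩
      ∑ (λ x → 2 * count (inversion (λ b → g (b ∷ x))) finEdges) P                             ≡⟨ ∑-*ˡ 2 _ P ⟩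
      2 * ∑ (λ x → count (inversion (λ b → g (b ∷ x))) finEdges) P                             ≡⟨ cong (2 *_) (∑-swap (λ x (a , b) → bit (not (g (a ∷ x)) ∧ g (b ∷ x))) P finEdges) ⟩
      2 * ∑ (λ (a , b) → count (λ x → not (g (a ∷ x)) ∧ g (b ∷ x)) P) finEdges                 ≤⟨ *-monoʳ-≤ 2 (∑-mono finEdges (λ (a , b) → contraction d (sortGrid-count d) (λ x → h (a ∷ x)) (λ x → h (b ∷ x)))) ⟩
      2 * ∑ (λ (a , b) → count (λ x → not (h (a ∷ x)) ∧ h (b ∷ x)) P) finEdges                 ≡⟨ cong (2 *_) (∑-cong finEdges (λ (a , b) → ∑-map _ (λ x → a ∷ x , b ∷ x) P)) ⟨
      2 * ∑ (λ (a , b) → count (inversion h) (map (λ x → a ∷ x , b ∷ x) P)) finEdges           ≡⟨ cong (2 *_) (∑-concatMap _ _ finEdges) ⟨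
      2 * count (inversion h) E₂                                                               ∎
    cost-slices : ∑ cˢ N ≤ 2 * count (inversion h) E₁
    cost-slices = begin
      ∑ cˢ N                                                                                   ≤⟨ ∑-mono N (λ a → proj₂ (proj₂ (sliceT a))) ⟩
      ∑ (λ a → 2 * count (inversion (λ y → h (a ∷ y))) (gridEdges d)) N                        ≡⟨ ∑-*ˡ 2 _ N ⟩
      2 * ∑ (λ a → count (inversion (λ y → h (a ∷ y))) (gridEdges d)) N                        ≡⟨ cong (2 *_) (∑-cong N (λ a → ∑-map _ (λ (x , y) → a ∷ x , a ∷ y) (gridEdges d))) ⟨
      2 * ∑ (λ a → count (inversion h) (map (λ (x , y) → a ∷ x , a ∷ y) (gridEdges d))) N      ≡⟨ cong (2 *_) (∑-concatMap _ _ N) ⟨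
      2 * count (inversion h) E₁                                                               ∎
    cost : ∑ cˡ P + ∑ cˢ N ≤ 2 * count (inversion h) (gridEdges (suc d))
    cost = begin
      ∑ cˡ P + ∑ cˢ N                                            ≤⟨ +-mono-≤ cost-lines cost-slices ⟩
      2 * count (inversion h) E₂ + 2 * count (inversion h) E₁    ≡⟨ +-comm (2 * count (inversion h) E₂) _ ⟩
      2 * count (inversion h) E₁ + 2 * count (inversion h) E₂    ≡⟨ *-distribˡ-+ 2 (count (inversion h) E₁) _ ⟨
      2 * (count (inversion h) E₁ + count (inversion h) E₂)      ≡⟨ cong (2 *_) (∑-++ _ E₁ E₂) ⟨
      2 * count (inversion h) (E₁ ++ E₂)                         ∎

-- The augmented hypergrid

unique-concatMap : ∀ {A B : Set} {f : A → List B} (label : B → A) → (∀ a → All (λ b → label b ≡ a) (f a)) →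
  (∀ a → Unique (f a)) → ∀ {as} → Unique as → Unique (concatMap f as)
unique-concatMap label labelled uf [] = []
unique-concatMap {f = f} label labelled uf {a ∷ as} (a∉ ∷ u) =
  Uniqueₚ.++⁺ (uf a) (unique-concatMap label labelled uf u) λ (b∈ , b∈′) →
    let a′ , a′∈ , b∈fa′ = find (∈-concatMap⁻ f {xs = as} b∈′)
    in All.lookup a∉ a′∈ (trans (sym (All.lookup (labelled a) b∈)) (All.lookup (labelled a′) b∈fa′))

allPoints-unique : ∀ n d → Unique (allPoints n d)
allPoints-unique n zero = [] ∷ []
allPoints-unique n (suc d) = unique-concatMap head (λ a → Allₚ.map⁺ (All.universal (λ _ → refl) _))
  (λ a → Uniqueₚ.map⁺ ∷-injectiveʳ (allPoints-unique n d)) (Uniqueₚ.allFin⁺ n)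

allPoints-complete : ∀ {n d} (x : Point n d) → x ∈ allPoints n d
allPoints-complete [] = here refl
allPoints-complete {n} {suc d} (a ∷ x) =
  ∈-concatMap⁺ (λ a → map (a ∷_) (allPoints n d)) (lose (∈-allFin a) (∈-map⁺ (a ∷_) (allPoints-complete x)))

module _ (k : ℕ) where
  open Sorting k

  finEdges-valid : All (λ (a , b) → ∃ λ c → toℕ b ≡ toℕ a + 2 ^ c) finEdges
  finEdges-valid = Allₚ.map⁻ {f = toℕ²} (subst (All _) (sym map-finEdges) (All.map proj₁ (lineEdges-valid k)))

  finEdges-unique : Unique finEdges
  finEdges-unique = Uniqueₚ.map⁻ (subst Unique (sym map-finEdges) (lineEdges-unique k))

  gridEdges-valid : ∀ d → All (λ (x , y) → IsEdge x y) (gridEdges d)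
  gridEdges-valid zero = []
  gridEdges-valid (suc d) = Allₚ.++⁺
    (Allₚ.concat⁺ (Allₚ.map⁺ (All.universal (λ a → Allₚ.map⁺ (All.map (edge-tail a) (gridEdges-valid d))) (allFin n))))
    (Allₚ.concat⁺ (Allₚ.map⁺ (All.map (λ (c , e) → Allₚ.map⁺ (All.universal (λ x → edge-head x c e) (allPoints n d))) finEdges-valid)))

  gridEdges-unique : ∀ d → Unique (gridEdges d)
  gridEdges-unique zero = []
  gridEdges-unique (suc d) = Uniqueₚ.++⁺
    (unique-concatMap (head ∘ proj₁) (λ a → Allₚ.map⁺ (All.universal (λ _ → refl) _))
      (λ a → Uniqueₚ.map⁺ (λ e → cong₂ _,_ (∷-injectiveʳ (cong proj₁ e)) (∷-injectiveʳ (cong proj₂ e))) (gridEdges-unique d)) (Uniqueₚ.allFin⁺ n))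
    (unique-concatMap (λ (x , y) → head x , head y) (λ a → Allₚ.map⁺ (All.universal (λ _ → refl) _))
      (λ a → Uniqueₚ.map⁺ (λ e → ∷-injectiveʳ (cong proj₁ e)) (allPoints-unique n d)) finEdges-unique)
    (λ (p , q) → All.lookup heads≢ q (All.lookup heads≡ p))
    where
    heads≡ : All (λ (x , y) → head x ≡ head y) (concatMap (λ a → map (λ (x , y) → a ∷ x , a ∷ y) (gridEdges d)) (allFin n))
    heads≡ = Allₚ.concat⁺ (Allₚ.map⁺ (All.universal (λ a → Allₚ.map⁺ (All.universal (λ _ → refl) (gridEdges d))) (allFin n)))
    heads≢ : All (λ (x , y) → head x ≢ head y) (concatMap (λ (a , b) → map (λ x → a ∷ x , b ∷ x) (allPoints n d)) finEdges)
    heads≢ = Allₚ.concat⁺ (Allₚ.map⁺ (All.map (λ (c , e) → Allₚ.map⁺ (All.universal (λ _ a≡b →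
      m+1+n≢m _ (trans (trans (cong (_ +_) (suc-pred (2 ^ c) {{>-nonZero (m^n>0 2 c)}})) (sym e)) (cong toℕ (sym a≡b)))) (allPoints n d))) finEdges-valid))

vec-ext : ∀ {A : Set} {d} {x y : Vec A d} → (∀ i → lookup x i ≡ lookup y i) → x ≡ y
vec-ext {x = []} {[]} e = refl
vec-ext {x = a ∷ x} {b ∷ y} e = cong₂ _∷_ (e Fin.zero) (vec-ext (e ∘ Fin.suc))

n<2^n : ∀ n → n < 2 ^ n
n<2^n zero = s≤s z≤n
n<2^n (suc n) = ≤-trans (+-mono-≤ (m^n>0 2 n) (n<2^n n)) (≤-reflexive (cong (2 ^ n +_) (sym (+-identityʳ _))))

module GridSteps (n d : ℕ) where

  -- `nothing` is the idle step, which pads walks to a common length. Exponents range over `Fin n`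
  -- to keep the generators finite; no edge is lost, since a < 2^a and 2^a is at most a coordinate
  -- of the upper endpoint, hence below `n`.
  Shift : Maybe (Fin d × Fin n) → Point n d → Point n d → Set
  Shift nothing x y = x ≡ y
  Shift (just (i , a)) x y = (∀ j → j ≢ i → lookup x j ≡ lookup y j) × toℕ (lookup y i) ≡ toℕ (lookup x i) + 2 ^ toℕ a

  _≟ᵖ_ : (x y : Point n d) → Dec (x ≡ y)
  _≟ᵖ_ = ≡-dec Fin._≟_

  shift? : ∀ g x y → Dec (Shift g x y)
  shift? nothing x y = x ≟ᵖ y
  shift? (just (i , a)) x y =
    all? (λ j → ¬? (j Fin.≟ i) →-dec (lookup x j Fin.≟ lookup y j)) ×-dec (toℕ (lookup y i) ≟ toℕ (lookup x i) + 2 ^ toℕ a)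

  shifts : List (Maybe (Fin d × Fin n))
  shifts = nothing ∷ map just (cartesianProduct (allFin d) (allFin n))

  shifts-complete : ∀ g → g ∈ shifts
  shifts-complete nothing = here refl
  shifts-complete (just (i , a)) = there (∈-map⁺ just (∈-cartesianProduct⁺ (∈-allFin i) (∈-allFin a)))

  shift-functional : ∀ {g x y z} → Shift g x y → Shift g x z → y ≡ z
  shift-functional {nothing} refl refl = refl
  shift-functional {just (i , a)} {x} {y} {z} (s , e) (t , f) = vec-ext same
    where
    same : ∀ j → lookup y j ≡ lookup z j
    same j with j Fin.≟ i
    ... | yes refl = toℕ-injective (trans e (sym f))
    ... | no ne = trans (sym (s j ne)) (t j ne)

  shift-injective : ∀ {g x y z} → Shift g x z → Shift g y z → x ≡ y
  shift-injective {nothing} refl refl = refl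
  shift-injective {just (i , a)} {x} {y} {z} (s , e) (t , f) = vec-ext same
    where
    same : ∀ j → lookup x j ≡ lookup y j
    same j with j Fin.≟ i
    ... | yes refl = toℕ-injective (+-cancelʳ-≡ (2 ^ toℕ a) _ _ (trans (sym e) f))
    ... | no ne = trans (s j ne) (sym (t j ne))

  -- Taking the second step first stays inside the grid: all steps go up, so coordinate `j` of the
  -- new intermediate point is at most that of `z`.
  shift-comm : ∀ {g h x y z} → Shift g x y → Shift h y z → ∃ λ w → Shift h x w × Shift g w z
  shift-comm {nothing} refl t = _ , t , refl
  shift-comm {just _} {nothing} s refl = _ , refl , s
  shift-comm {just (i , a)} {just (j , b)} {x} {y} {z} (s , e) (t , f) = w , (below , at-j) , (away , at-i)
    where
    x≤y : toℕ (lookup x j) ≤ toℕ (lookup y j)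
    x≤y with j Fin.≟ i
    ... | yes refl = ≤-trans (m≤m+n _ (2 ^ toℕ a)) (≤-reflexive (sym e))
    ... | no ne = ≤-reflexive (cong toℕ (s j ne))
    v< : toℕ (lookup x j) + 2 ^ toℕ b < n
    v< = ≤-<-trans (+-monoˡ-≤ (2 ^ toℕ b) x≤y) (≤-<-trans (≤-reflexive (sym f)) (toℕ<n (lookup z j)))
    w : Point n d
    w = x [ j ]≔ fromℕ< v<
    at-j : toℕ (lookup w j) ≡ toℕ (lookup x j) + 2 ^ toℕ b
    at-j = trans (cong toℕ (lookup∘update j x _)) (toℕ-fromℕ< v<)
    below : ∀ l → l ≢ j → lookup x l ≡ lookup w l
    below l ne = sym (lookup∘update′ ne x _)
    away : ∀ l → l ≢ i → lookup w l ≡ lookup z l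
    away l ne with l Fin.≟ j
    ... | yes refl = toℕ-injective (trans at-j (trans (cong (λ c → toℕ c + 2 ^ toℕ b) (s l ne)) (sym f)))
    ... | no ne′ = trans (sym (below l ne′)) (trans (s l ne) (t l ne′))
    at-i : toℕ (lookup z i) ≡ toℕ (lookup w i) + 2 ^ toℕ a
    at-i with i Fin.≟ j
    ... | yes refl = trans f (trans (cong (_+ 2 ^ toℕ b) e) (trans (exchange (toℕ (lookup x i)) _ _) (cong (_+ 2 ^ toℕ a) (sym at-j))))
      where
      exchange : ∀ p q r → p + q + r ≡ p + r + q
      exchange = solve-∀
    ... | no ne = trans (cong toℕ (sym (t i ne))) (trans e (cong (λ c → toℕ c + 2 ^ toℕ a) (below i ne)))

  open Routing _≟ᵖ_ (allPoints n d) (allPoints-unique n d) allPoints-complete shifts Shift shift? (λ {g} _ → shifts-complete g)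
    (λ {g} → shift-functional {g}) (λ {g} → shift-injective {g}) (λ {g} {h} → shift-comm {g} {h}) public

  edge⇒shift : ∀ {x y} → IsEdge x y → ∃ λ g → Shift g x y
  edge⇒shift {x} {y} (i , same , a , e) = just (i , fromℕ< a<n) , same , trans e (cong (λ a → toℕ (lookup x i) + 2 ^ a) (sym (toℕ-fromℕ< a<n)))
    where
    a<n : a < n
    a<n = <-trans (n<2^n a) (≤-<-trans (≤-trans (m≤n+m _ _) (≤-reflexive (sym e))) (toℕ<n (lookup y i)))

  walk⇒reach : ∀ {ℓ x y} → Walk ℓ x y → Reach ℓ x y
  walk⇒reach [] = []
  walk⇒reach (_∷_ {x = x} {y} e p) = let g , s = edge⇒shift {x} {y} e in _∷_ {g = g} s (walk⇒reach p)

  pad : ∀ {ℓ K x y} → ℓ ≤ K → Reach ℓ x y → Reach K x y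
  pad {K = zero} z≤n r = r
  pad {K = suc K} z≤n r = _∷_ {g = nothing} refl (pad z≤n r)
  pad (s≤s le) (s ∷ r) = s ∷ pad le r

  -- Markov's inequality. A pair with `p x` that is left out has a walk of at least `suc K` steps
  -- and is paid for by the total cost `c`; the walks that are kept are padded to length exactly
  -- `K`.
  select-short : ∀ K (p : Point n d → Bool) {c xs ys} → Paired Walk c xs ys →
    ∃₂ λ R S → ∃ (Split xs R) × ∃ (Split ys S) × Pointwise (Reach K) R S × All (λ x → p x ≡ true) R ×
      count p xs * suc K ≤ length R * suc K + c
  select-short K p [] = [] , [] , ([] , []) , ([] , []) , [] , [] , z≤n
  select-short K p (_∷_ {ℓ} {c} {x} {y} {xs} w pw) with select-short K p pw | p x in px | ℓ ≤? K
  ... | R , S , (_ , s) , (_ , t) , q , a , le | false | _ =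
    R , S , (_ , right s) , (_ , right t) , q , a , ≤-trans le (+-monoʳ-≤ (length R * suc K) (m≤n+m c ℓ))
  ... | R , S , (_ , s) , (_ , t) , q , a , le | true | yes ℓ≤K =
    x ∷ R , y ∷ S , (_ , left s) , (_ , left t) , pad ℓ≤K (walk⇒reach w) ∷ q , px ∷ a , (begin
      suc K + count p xs * suc K            ≤⟨ +-monoʳ-≤ (suc K) le ⟩
      suc K + (length R * suc K + c)        ≡⟨ +-assoc (suc K) (length R * suc K) c ⟨
      suc K + length R * suc K + c          ≤⟨ +-monoʳ-≤ (suc K + length R * suc K) (m≤n+m c ℓ) ⟩
      suc K + length R * suc K + (ℓ + c)    ∎)
    where open ≤-Reasoning
  ... | R , S , (_ , s) , (_ , t) , q , a , le | true | no ℓ≰K =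
    R , S , (_ , right s) , (_ , right t) , q , a , (begin
      suc K + count p xs * suc K            ≤⟨ +-mono-≤ (≰⇒> ℓ≰K) le ⟩
      ℓ + (length R * suc K + c)            ≡⟨ exchange ℓ (length R * suc K) c ⟩
      length R * suc K + (ℓ + c)            ∎)
    where
    open ≤-Reasoning
    exchange : ∀ a b c → a + (b + c) ≡ b + (a + c)
    exchange = solve-∀

  endpoints : List (Pair n d) → List (Point n d)
  endpoints [] = []
  endpoints ((x , y) ∷ M) = x ∷ y ∷ endpoints M

  length-endpoints : ∀ M → length (endpoints M) ≡ 2 * length M
  length-endpoints [] = refl
  length-endpoints (_ ∷ M) = trans (cong (2 +_) (length-endpoints M)) (sym (*-suc 2 (length M)))

  Touches : List (Pair n d) → Pair n d → Set
  Touches M (x , y) = x ∈ endpoints M ⊎ y ∈ endpoints M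

  disjoint : ∀ {x y} M → x ∉ endpoints M → y ∉ endpoints M → All (VertexDisjoint (x , y)) M
  disjoint [] x∉ y∉ = []
  disjoint ((x′ , y′) ∷ M) x∉ y∉ =
    (x∉ ∘ here , x∉ ∘ there ∘ here , y∉ ∘ here , y∉ ∘ there ∘ here) ∷ disjoint M (x∉ ∘ there ∘ there) (y∉ ∘ there ∘ there)

  -- Greedy choice: an edge is added unless it meets an endpoint already in use, so every edge of
  -- `L` ends up touched. The endpoints then serve as the cut.
  maximal-matching : ∀ f (L : List (Pair n d)) → All (InS⁻ f) L →
    ∃ λ M → IsMatchingInS⁻ f M × length M ≤ length L × All (Touches M) L
  maximal-matching f [] [] = [] , ([] , []) , z≤n , []
  maximal-matching f ((x , y) ∷ L) (e ∷ es) with maximal-matching f L es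
  ... | M , (inS , vd) , le , touch with x ∈? endpoints M | y ∈? endpoints M
    where open DecMembership _≟ᵖ_ using (_∈?_)
  ...   | yes x∈ | _ = M , (inS , vd) , m≤n⇒m≤1+n le , inj₁ x∈ ∷ touch
  ...   | no _ | yes y∈ = M , (inS , vd) , m≤n⇒m≤1+n le , inj₂ y∈ ∷ touch
  ...   | no x∉ | no y∉ =
    (x , y) ∷ M , (e ∷ inS , disjoint M x∉ y∉ ∷ vd) , s≤s le ,
    inj₁ (here refl) ∷ All.map [ inj₁ ∘ there ∘ there , inj₂ ∘ there ∘ there ]′ touch

  shift-InS⁻ : ∀ {f : BoolFn n d} {g x y} → Shift g x y → f x ≡ true → f y ≡ false → InS⁻ f (x , y)
  shift-InS⁻ {g = nothing} refl fx fy = contradiction (trans (sym fx) fy) λ ()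
  shift-InS⁻ {g = just (i , a)} (same , e) fx fy = (i , same , toℕ a , e) , fx , fy

  -- The first drop of `f` along the walk would be a violated edge, and one of its two ends would
  -- lie in the cut.
  avoiding-path : ∀ {f : BoolFn n d} {M} → (∀ e → InS⁻ f e → Touches M e) →
    ∀ {k x y} → Avoids (endpoints M) k x y → f x ≡ true → f y ≡ true
  avoiding-path cover [ _ ] fx = fx
  avoiding-path {f} cover (_∷_ {g = g} {y = y} (x∉ , s) a) fx with f y in fy
  ... | true = avoiding-path cover a fy
  ... | false = ⊥-elim ([ x∉ , start a ]′ (cover _ (shift-InS⁻ {g = g} s fx fy)))
    where
    start : ∀ {C k x y} → Avoids C k x y → x ∉ C
    start [ x∉ ] = x∉
    start ((x∉ , _) ∷ _) = x∉

-- The isoperimetric inequality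

count-filterᵇ : ∀ {A : Set} (p q : A → Bool) xs → count p (filterᵇ q xs) ≡ count (λ x → q x ∧ p x) xs
count-filterᵇ p q [] = refl
count-filterᵇ p q (x ∷ xs) with q x
... | true = cong (bit (p x) +_) (count-filterᵇ p q xs)
... | false = count-filterᵇ p q xs

∈-filterᵇ⁻ : ∀ {A : Set} (h : A → Bool) {x xs} → x ∈ filterᵇ h xs → h x ≡ true
∈-filterᵇ⁻ h {xs = xs} x∈ = Equivalence.to T-≡ (proj₂ (∈-filter⁻ (Bool.T? ∘ h) {xs = xs} x∈))

-- The choice of `K` makes 4s at most ut, so half of the left-hand side absorbs the term 2s, which
-- leaves u ≤ 4μt. Rounding lets t exceed 4s/u by at most 1; the extra u in tu is bounded by 4s
-- through the case K = 0 and μ ≤ s, so tu ≤ 8s.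
optimise : ∀ u μ s → μ ≤ s → (∀ K → u * suc K ≤ suc K * (2 * μ) * suc K + 2 * s) → u * u ≤ 32 * (s * μ)
optimise zero μ s μ≤s bound = z≤n
optimise u@(suc _) μ s μ≤s bound = begin
  u * u                          ≤⟨ *-monoˡ-≤ u u≤4μt ⟩
  4 * μ * t * u                  ≡⟨ *-assoc (4 * μ) t u ⟩
  4 * μ * (u + K * u)            ≤⟨ *-monoʳ-≤ (4 * μ) (+-mono-≤ u≤4s (m/n*n≤m (4 * s) u)) ⟩
  4 * μ * (4 * s + 4 * s)        ≡⟨ collect μ s ⟩
  32 * (s * μ)                   ∎
  where
  open ≤-Reasoning
  K = 4 * s / u
  t = suc K
  collect : ∀ μ s → 4 * μ * (4 * s + 4 * s) ≡ 32 * (s * μ)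
  collect = solve-∀
  u≤4s : u ≤ 4 * s
  u≤4s = begin
    u                              ≡⟨ *-identityʳ u ⟨
    u * 1                          ≤⟨ bound 0 ⟩
    1 * (2 * μ) * 1 + 2 * s        ≤⟨ +-monoˡ-≤ (2 * s) (*-monoˡ-≤ 1 (*-monoʳ-≤ 1 (*-monoʳ-≤ 2 μ≤s))) ⟩
    1 * (2 * s) * 1 + 2 * s        ≡⟨ double s ⟩
    4 * s                          ∎
    where
    double : ∀ s → 1 * (2 * s) * 1 + 2 * s ≡ 4 * s
    double = solve-∀
  4s≤ut : 4 * s ≤ u * t
  4s≤ut = begin
    4 * s                          ≡⟨ m≡m%n+[m/n]*n (4 * s) u ⟩
    4 * s % u + K * u              ≤⟨ +-monoˡ-≤ (K * u) (<⇒≤ (m%n<n (4 * s) u)) ⟩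
    u + K * u                      ≡⟨ *-comm t u ⟩
    u * t                          ∎
  u≤4μt : u ≤ 4 * μ * t
  u≤4μt = *-cancelʳ-≤ u (4 * μ * t) t (+-cancelʳ-≤ (u * t) (u * t) (4 * μ * t * t) (begin
    u * t + u * t                  ≡⟨ twice (u * t) ⟩
    2 * (u * t)                    ≤⟨ *-monoʳ-≤ 2 (bound K) ⟩
    2 * (t * (2 * μ) * t + 2 * s)  ≡⟨ expand t μ s ⟩
    4 * μ * t * t + 4 * s          ≤⟨ +-monoʳ-≤ (4 * μ * t * t) 4s≤ut ⟩
    4 * μ * t * t + u * t          ∎))
    where
    twice : ∀ a → a + a ≡ 2 * a
    twice = solve-∀
    expand : ∀ t μ s → 2 * (t * (2 * μ) * t + 2 * s) ≡ 4 * μ * t * t + 4 * s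
    expand = solve-∀

module _ (k d : ℕ) (f : BoolFn (2 ^ k) d) where
  open Sorting k
  open GridSteps n d

  private
    P = allPoints n d
    h σ : BoolFn n d
    h = not ∘ f
    σ = sortGrid d h

  sorted : BoolFn n d
  sorted = not ∘ σ

  sorted-monotone : Monotone sorted
  sorted-monotone x y x⪯y with σ x in ex | σ y in ey
  ... | true | true = Bool.b≤b
  ... | true | false = Bool.f≤t
  ... | false | false = Bool.b≤b
  ... | false | true = contradiction (trans (sym ex) (sortGrid-antitone d h x y x⪯y ey)) λ ()

  moved : ℕ
  moved = count (λ x → σ x ∧ f x) P

  -- Sorting keeps the number of zeros, so as many zeros arrive at ones of `f` as disappear from
  -- zeros of `f`, and these are the points where the two functions differ.
  dist-sorted : dist f sorted ≡ 2 * moved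
  dist-sorted = begin
    dist f sorted                                                          ≡⟨ length-filter≡# (λ x → ¬? (f x Bool.≟ sorted x)) P ⟩
    # (λ x → ¬? (f x Bool.≟ sorted x)) P                                   ≡⟨ ∑-cong P (λ x → split (σ x) (f x)) ⟩
    ∑ (λ x → bit (σ x ∧ f x) + bit (not (σ x) ∧ h x)) P                    ≡⟨ ∑-+ (λ x → bit (σ x ∧ f x)) _ P ⟩
    moved + count (λ x → not (σ x) ∧ h x) P                                ≡⟨ cong (moved +_) balance ⟩
    moved + moved                                                          ≡⟨ cong (moved +_) (sym (+-identityʳ moved)) ⟩
    2 * moved                                                              ∎
    where
    open ≡-Reasoning
    both = count (λ x → σ x ∧ h x) P
    split : ∀ a b → ind (¬? (b Bool.≟ not a)) ≡ bit (a ∧ b) + bit (not a ∧ not b)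
    split true true = refl
    split true false = refl
    split false true = refl
    split false false = refl
    by-σ : ∀ a b → bit (not b) ≡ bit (not a ∧ not b) + bit (a ∧ not b)
    by-σ true b = refl
    by-σ false b = sym (+-identityʳ _)
    by-f : ∀ a b → bit a ≡ bit (a ∧ b) + bit (a ∧ not b)
    by-f true true = refl
    by-f true false = refl
    by-f false b = refl
    balance : count (λ x → not (σ x) ∧ h x) P ≡ moved
    balance = +-cancelʳ-≡ both _ _ (begin
      count (λ x → not (σ x) ∧ h x) P + both                               ≡⟨ ∑-+ (λ x → bit (not (σ x) ∧ h x)) _ P ⟨
      ∑ (λ x → bit (not (σ x) ∧ h x) + bit (σ x ∧ h x)) P                  ≡⟨ ∑-cong P (λ x → by-σ (σ x) (f x)) ⟨
      count h P                                                            ≡⟨ sortGrid-count d h ⟨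
      count σ P                                                            ≡⟨ ∑-cong P (λ x → by-f (σ x) (f x)) ⟩
      ∑ (λ x → bit (σ x ∧ f x) + bit (σ x ∧ h x)) P                        ≡⟨ ∑-+ (λ x → bit (σ x ∧ f x)) _ P ⟩
      moved + both                                                         ∎)

  inversions≤ : (L : List (Pair n d)) → (∀ e → InS⁻ f e → e ∈ L) → count (inversion h) (gridEdges d) ≤ length L
  inversions≤ L complete = begin
    count (inversion h) (gridEdges d)               ≡⟨ length-filterᵇ (inversion h) (gridEdges d) ⟨
    length (filterᵇ (inversion h) (gridEdges d))    ≤⟨ unique-length≤ (Uniqueₚ.filter⁺ (Bool.T? ∘ inversion h) (gridEdges-unique k d)) violated ⟩
    length L                                        ∎
    where
    open ≤-Reasoning
    bits : ∀ a b → not (not a) ∧ not b ≡ true → a ≡ true × b ≡ false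
    bits true false _ = refl , refl
    violated : ∀ {e} → e ∈ filterᵇ (inversion h) (gridEdges d) → e ∈ L
    violated {x , y} e∈ = complete (x , y)
      (All.lookup (gridEdges-valid k d) (proj₁ (∈-filter⁻ (Bool.T? ∘ inversion h) {xs = gridEdges d} e∈)) ,
       bits (f x) (f y) (∈-filterᵇ⁻ (inversion h) {xs = gridEdges d} e∈))

  -- The sources are the points that receive a zero although `f` is 1 there; the targets are zeros
  -- of `f`. Pairs joined within `K` steps are limited by the cut of 2|M| endpoints, longer ones by
  -- the total cost of the sort.
  routing-bound : (L M : List (Pair n d)) → (∀ e → InS⁻ f e → e ∈ L) → All (Touches M) L →
    ∀ K → moved * suc K ≤ suc K * (2 * length M) * suc K + 2 * length L
  routing-bound L M complete touch K with sortGrid-transport d h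
  ... | c , (ys , paired , ys↭) , c≤ with select-short K f paired
  ...   | R , S , (_ , s) , (_ , t) , pw , R-true , bound = begin
    moved * suc K                                          ≡⟨ cong (_* suc K) (sym (count-filterᵇ f σ P)) ⟩
    count f (support d σ) * suc K                          ≤⟨ bound ⟩
    length R * suc K + c                                   ≤⟨ +-mono-≤ (*-monoˡ-≤ (suc K) |R|≤) (≤-trans c≤ (*-monoʳ-≤ 2 (inversions≤ L complete))) ⟩
    suc K * (2 * length M) * suc K + 2 * length L          ∎
    where
    open ≤-Reasoning
    uR : Unique R
    uR = split-unique s (Uniqueₚ.filter⁺ (Bool.T? ∘ σ) (allPoints-unique n d))
    uS : Unique S
    uS = split-unique t (unique-↭ (↭-sym ys↭) (Uniqueₚ.filter⁺ (Bool.T? ∘ h) (allPoints-unique n d)))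
    S-false : ∀ {y} → y ∈ S → not (f y) ≡ true
    S-false y∈ = ∈-filterᵇ⁻ h {xs = P} (Perm.∈-resp-↭ ys↭ (split-∈ t y∈))
    blocked : ∀ {x y} → x ∈ R → y ∈ S → ¬ Avoids (endpoints M) K x y
    blocked x∈ y∈ a with avoiding-path {f} {M} (λ e e∈S → All.lookup touch (complete e e∈S)) a (All.lookup R-true x∈) | S-false y∈
    ... | fy | ¬fy rewrite fy = contradiction ¬fy λ ()
    |R|≤ : length R ≤ suc K * (2 * length M)
    |R|≤ = ≤-trans (cut-size K (endpoints M) (pw , uR , uS) blocked) (≤-reflexive (cong (suc K *_) (length-endpoints M)))

-- Passage to the rational numbers

ℕtoℚᵘ : ∀ m → Q.toℚᵘ (ℕtoℚ m) ℚᵘ.≃ ℚᵘ.mkℚᵘ (ℤ.+ m) 0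
ℕtoℚᵘ m = Q.toℚᵘ-fromℚᵘ (ℚᵘ.mkℚᵘ (ℤ.+ m) 0)

ℕtoℚ-* : ∀ a b → ℕtoℚ (a * b) ≡ ℕtoℚ a Q.* ℕtoℚ b
ℕtoℚ-* a b = Q.toℚᵘ-injective (begin
  Q.toℚᵘ (ℕtoℚ (a * b))                          ≈⟨ ℕtoℚᵘ (a * b) ⟩
  ℚᵘ.mkℚᵘ (ℤ.+ (a * b)) 0                          ≡⟨ cong (λ z → ℚᵘ.mkℚᵘ z 0) (ℤ.pos-* a b) ⟩
  ℚᵘ.mkℚᵘ (ℤ.+ a) 0 ℚᵘ.* ℚᵘ.mkℚᵘ (ℤ.+ b) 0           ≈⟨ ℚᵘ.*-cong (ℕtoℚᵘ a) (ℕtoℚᵘ b) ⟨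
  Q.toℚᵘ (ℕtoℚ a) ℚᵘ.* Q.toℚᵘ (ℕtoℚ b)           ≈⟨ Q.toℚᵘ-homo-* (ℕtoℚ a) (ℕtoℚ b) ⟨
  Q.toℚᵘ (ℕtoℚ a Q.* ℕtoℚ b)                     ∎)
  where open import Relation.Binary.Reasoning.Setoid ℚᵘ.≃-setoid

ℕtoℚ-mono : ∀ {a b} → a ≤ b → ℕtoℚ a Q.≤ ℕtoℚ b
ℕtoℚ-mono {a} {b} a≤b = Q.toℚᵘ-cancel-≤ (begin
  Q.toℚᵘ (ℕtoℚ a)     ≃⟨ ℕtoℚᵘ a ⟩
  ℚᵘ.mkℚᵘ (ℤ.+ a) 0     ≤⟨ ℚᵘ.*≤* (ℤ.*-monoʳ-≤-nonNeg (ℤ.+ 1) (ℤ.+≤+ a≤b)) ⟩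
  ℚᵘ.mkℚᵘ (ℤ.+ b) 0     ≃⟨ ℕtoℚᵘ b ⟨
  Q.toℚᵘ (ℕtoℚ b)     ∎)
  where open ℚᵘ.≤-Reasoning

-- In the application 2u is the distance to the sorted function and `s` stands for |S⁻| |M|. The
-- hypotheses combine to (εN)² ≤ (2u)² ≤ 4 · 32 s, which is the origin of 128.
square-bound : ∀ (ε : ℚ) N u s → 0ℚ Q.< ε → ε Q.* ℕtoℚ N Q.≤ ℕtoℚ (2 * u) → u * u ≤ 32 * s →
  (ℤ.+ 1 Q./ 128) Q.* (ε Q.* ε) Q.* ℕtoℚ (N * N) Q.≤ ℕtoℚ s
square-bound ε N u s ε>0 far u²≤ = begin
  c Q.* (ε Q.* ε) Q.* ℕtoℚ (N * N)             ≡⟨ cong (c Q.* (ε Q.* ε) Q.*_) (ℕtoℚ-* N N) ⟩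
  c Q.* (ε Q.* ε) Q.* (X Q.* X)                ≡⟨ Q.*-assoc c (ε Q.* ε) (X Q.* X) ⟩
  c Q.* ((ε Q.* ε) Q.* (X Q.* X))              ≡⟨ cong (c Q.*_) (interchange ε ε X X) ⟩
  c Q.* ((ε Q.* X) Q.* (ε Q.* X))              ≤⟨ Q.*-monoˡ-≤-nonNeg c (Q.≤-trans (Q.*-monoˡ-≤-nonNeg (ε Q.* X) {{Q.nonNegative εX≥0}} far) (Q.*-monoʳ-≤-nonNeg Y {{Q.nonNegative Y≥0}} far)) ⟩
  c Q.* (Y Q.* Y)                              ≡⟨ cong (c Q.*_) (ℕtoℚ-* (2 * u) (2 * u)) ⟨
  c Q.* ℕtoℚ (2 * u * (2 * u))                 ≤⟨ Q.*-monoˡ-≤-nonNeg c (ℕtoℚ-mono 4u²≤) ⟩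
  c Q.* ℕtoℚ (128 * s)                         ≡⟨ cong (c Q.*_) (ℕtoℚ-* 128 s) ⟩
  c Q.* (ℕtoℚ 128 Q.* ℕtoℚ s)                  ≡⟨ Q.*-assoc c (ℕtoℚ 128) (ℕtoℚ s) ⟨
  -- The product of the closed rationals `c` and 128 evaluates to 1.
  c Q.* ℕtoℚ 128 Q.* ℕtoℚ s                    ≡⟨ Q.*-identityˡ (ℕtoℚ s) ⟩
  ℕtoℚ s                                       ∎
  where
  open Q.≤-Reasoning
  open Algebra.Properties.CommutativeSemigroup (Algebra.Bundles.CommutativeMonoid.commutativeSemigroup Q.*-1-commutativeMonoid) using (interchange)
  c = ℤ.+ 1 Q./ 128
  X = ℕtoℚ N
  Y = ℕtoℚ (2 * u)
  X≥0 : 0ℚ Q.≤ X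
  X≥0 = ℕtoℚ-mono {0} {N} z≤n
  Y≥0 : 0ℚ Q.≤ Y
  Y≥0 = ℕtoℚ-mono {0} {2 * u} z≤n
  εX≥0 : 0ℚ Q.≤ ε Q.* X
  εX≥0 = Q.≤-trans (Q.≤-reflexive (sym (Q.*-zeroʳ ε))) (Q.*-monoˡ-≤-nonNeg ε {{Q.nonNegative (Q.<⇒≤ ε>0)}} X≥0)
  4u²≤ : 2 * u * (2 * u) ≤ 128 * s
  4u²≤ = ≤-trans (≤-reflexive (four u)) (≤-trans (*-monoʳ-≤ 4 u²≤) (≤-reflexive (sym (*-assoc 4 32 s))))
    where
    four : ∀ u → 2 * u * (2 * u) ≡ 4 * (u * u)
    four = solve-∀

theorem2p1 : Σ ℚ λ c → 0ℚ Q.< c ×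
    (∀ (n d : ℕ) → IsPowerOf2 n → (f : BoolFn n d) → (ε : ℚ) → 0ℚ Q.< ε → EpsFar ε f →
    ∀ (k : ℕ) → CardS⁻ f k →
    ∃ λ (M : List (Pair n d)) → IsMatchingInS⁻ f M ×
    c Q.* (ε Q.* ε) Q.* ℕtoℚ (n ^ d * n ^ d) Q.≤ ℕtoℚ (k * length M))
theorem2p1 = ℤ.+ 1 Q./ 128 , Q.positive⁻¹ (ℤ.+ 1 Q./ 128) , λ where
  .(2 ^ k) d (k , refl) f ε ε>0 far .(length L) (L , _ , L⇔S⁻ , refl) →
    let open GridSteps (2 ^ k) d using (maximal-matching)
        complete = λ e → Equivalence.from (L⇔S⁻ e)
        M , matching , |M|≤|L| , touch = maximal-matching f L (All.tabulate (Equivalence.to (L⇔S⁻ _)))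
    in M , matching , square-bound ε ((2 ^ k) ^ d) (moved k d f) (length L * length M) ε>0
         (subst (λ m → ε Q.* ℕtoℚ ((2 ^ k) ^ d) Q.≤ ℕtoℚ m) (dist-sorted k d f) (far (sorted k d f) (sorted-monotone k d f)))
         (optimise (moved k d f) (length M) (length L) |M|≤|L| (routing-bound k d f L M complete touch))
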